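{- Let $k\geqslant2$ and let $f$ be a $k$-regular sequence such that $\rho=\rho({\bf B})$ is the unique dominant eigenvalue of ${\bf B}$ and $\rho({\bf B})>\rho^*(\mathcal B)$. Let ${\bf F}:\mathbb R\to\mathbb R^d$ be the solution of the dilation equation $${\bf F}(x)=\sum_{a=0}^{k-1}\rho^{ -1}{\bf B}_a{\bf F}(kx-a),\qquad {\bf F}(x)={\bf 0}\ (x\leqslant0),\quad {\bf F}(x)={\bf v}_\rho\ (x\geqslant1).$$ For $j\in\{0,\dots,k-1\}$ define $S_j:\mathbb R^{d+1}\to\mathbb R^{d+1}$ by $$S_j(y_0,{\bf y})=\Big(\tfrac{y_0+j}{k},\ \rho^{ -1}{\bf B}_j{\bf y}+\sum_{a=0}^{j-1}\rho^{ -1}{\bf B}_a{\bf v}_\rho\Big),\qquad y_0\in\mathbb R,\ {\bf y}\in\mathbb R^d.$$ Then the graph $\mathcal F_f=\{(x,{\bf F}(x)):x\in[0,1]\}$ satisfies $\mathcal F_f=\bigcup_{j=0}^{k-1}S_j(\mathcal F_f)$; that is, $\mathcal F_f$ is the self-affine set (attractor) of the iterated function system $\{S_0,\dots,S_{k-1}\}$.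
   Context: Let $k\geqslant2$. An integer sequence $f=(f(m))_{m\geqslant0}$ is $k$-regular if the $\mathbb Q$-vector space spanned by its $k$-kernel $\{(f(k^\ell n+r))_{n\geqslant0}:\ell\geqslant0,\ 0\leqslant r<k^\ell\}$ is finite-dimensional. Fix a basis $f=f_1,\dots,f_d$ of this space of integer sequences and put ${\bf f}(m)=(f_1(m),\dots,f_d(m))$ (row vector). The digit matrices ${\bf B}_0,\dots,{\bf B}_{k-1}\in\mathbb Z^{d\times d}$ are defined by ${\bf f}(km+a)={\bf f}(m){\bf B}_a$ for all $m\geqslant0$, $0\leqslant a<k$; $\mathcal B=\{{\bf B}_0,\dots,{\bf B}_{k-1}\}$ and ${\bf B}=\sum_a{\bf B}_a$. $\rho({\bf M})$ denotes spectral radius; the joint spectral radius is $\rho^*(\mathcal B)=\limsup_{n\to\infty}\max_{i_0,\dots,i_{n-1}}\|{\bf B}_{i_0}\cdots{\bf B}_{i_{n-1}}\|^{1/n}$ (operator norm). "$\rho({\bf B})$ is the unique dominant eigenvalue" means $\rho=\rho({\bf B})$ is a simple eigenvalue of ${\bf B}$ and every other eigenvalue has modulus $<\rho$; ${\bf v}_\rho$ is a fixed column eigenvector with ${\bf B}{\bf v}_\rho=\rho{\bf v}_\rho$. Under $\rho>\rho^*(\mathcal B)$ the dilation equation above has a unique (continuous) solution ${\bf F}$. A self-affine set is the attractor (unique nonempty compact $K$ with $K=\bigcup_iS_i(K)$) of finitely many ($\geqslant2$) affine contractions. -}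

module Defs where

open import Level using (Level; 0ℓ) renaming (suc to lsuc)
open import Algebra.Bundles using (CommutativeRing; RawRing)
import Algebra.Construct.NaturalChoice.Max as Max
import Algebra.Definitions.RawMagma as RawMagmaDefs
import Algebra.Definitions.RawSemiring as RawSemiringDefs
open import Data.Bool.Base using (if_then_else_)
open import Data.Fin.Base using (Fin; zero; suc; toℕ; inject; punchIn)
open import Data.Fin.Properties using (_≟_)
open import Data.Integer.Base as ℤ using (ℤ; +_; -[1+_])
open import Data.List.Base as List using (List)
open import Data.List.Relation.Unary.Any using (Any)
open import Data.Nat.Base as ℕ using (ℕ; zero; suc)
open import Data.Product.Base using (Σ-syntax; ∃; ∃-syntax; _×_; _,_; proj₁; proj₂)
open import Data.Rational.Base as ℚ using (ℚ)
open import Data.Vec.Functional as Vector using (Vector; head; tail; _∷_)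
import Data.Vec.Functional.Relation.Binary.Equality.Setoid as VectorEquality
open import Relation.Binary.Bundles using (TotalOrder)
open import Relation.Binary.Core using (Rel)
open import Relation.Binary.PropositionalEquality using (_≡_; _≗_)
open import Relation.Binary.Structures using (IsTotalOrder)
import Relation.Binary.Construct.NonStrictToStrict as NonStrictToStrict
open import Relation.Nullary using (¬_)
open import Relation.Nullary.Decidable using (does)
open import Relation.Unary using (Pred; _∈_; _≐_; _⊆_; Satisfiable; ⋃)

------------------------------------------------------------------------
-- Matrices and polynomials

Matrix : ∀ {a} → Set a → ℕ → Set a
Matrix A n = Vector (Vector A n) n

module LinearAlgebra {c ℓ : Level} (K : RawRing c ℓ) where
  open RawRing K
  open RawSemiringDefs rawSemiring using (sum; _^_) public

  infixl 7 _∙_ _∗_ _⊛_ _·_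

  _∙_ : ∀ {n} → Carrier → Vector Carrier n → Vector Carrier n
  (t ∙ x) i = t * x i

  _∗_ : ∀ {n} → Matrix Carrier n → Vector Carrier n → Vector Carrier n
  (M ∗ x) i = sum λ j → M i j * x j

  _⊛_ : ∀ {n} → Vector Carrier n → Matrix Carrier n → Vector Carrier n
  (x ⊛ M) j = sum λ i → x i * M i j

  _·_ : ∀ {n} → Matrix Carrier n → Matrix Carrier n → Matrix Carrier n
  (M · N) i j = sum λ l → M i l * N l j

  identity : ∀ {n} → Matrix Carrier n
  identity i j = if does (i ≟ j) then 1# else 0#

  sumᴹ : ∀ {m n} → Vector (Matrix Carrier n) m → Matrix Carrier n
  sumᴹ Ms i j = sum λ a → Ms a i j

  sumⱽ : ∀ {m n} → Vector (Vector Carrier n) m → Vector Carrier n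
  sumⱽ xs i = sum λ a → xs a i

  det : ∀ {n} → Matrix Carrier n → Carrier
  det {zero}  M = 1#
  det {suc n} M =
    sum λ j → (- 1#) ^ toℕ j * (M zero j * det λ a b → M (suc a) (punchIn j b))

  IsNonZero : ∀ {n} → Vector Carrier n → Set ℓ
  IsNonZero x = ¬ (∀ i → x i ≈ 0#)

  IsEigenvector : ∀ {n} → Matrix Carrier n → Carrier → Vector Carrier n → Set ℓ
  IsEigenvector M t x = IsNonZero x × (∀ i → (M ∗ x) i ≈ (t ∙ x) i)

  IsEigenvalue : ∀ {n} → Matrix Carrier n → Carrier → Set _
  IsEigenvalue M t = ∃[ x ] IsEigenvector M t x

-- A polynomial is the list of its coefficients, constant term first;
-- trailing zeros are irrelevant.
module Polynomials {c ℓ : Level} (K : RawRing c ℓ) where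
  open RawRing K

  Poly : Set c
  Poly = List Carrier

  coeff : Poly → ℕ → Carrier
  coeff List.[]      _       = 0#
  coeff (a List.∷ p) zero    = a
  coeff (a List.∷ p) (suc n) = coeff p n

  _+ᴾ_ : Poly → Poly → Poly
  List.[]      +ᴾ q            = q
  (a List.∷ p) +ᴾ List.[]      = a List.∷ p
  (a List.∷ p) +ᴾ (b List.∷ q) = (a + b) List.∷ (p +ᴾ q)

  _*ᴾ_ : Poly → Poly → Poly
  List.[]      *ᴾ q = List.[]
  (a List.∷ p) *ᴾ q = List.map (a *_) q +ᴾ (0# List.∷ (p *ᴾ q))

  polyRing : RawRing c ℓ
  polyRing = record
    { Carrier = Poly
    ; _≈_     = λ p q → ∀ n → coeff p n ≈ coeff q n
    ; _+_     = _+ᴾ_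
    ; _*_     = _*ᴾ_
    ; -_      = List.map -_
    ; 0#      = List.[]
    ; 1#      = List.[ 1# ]
    }

  constant : Carrier → Poly
  constant a = List.[ a ]

  X : Poly
  X = 0# List.∷ 1# List.∷ List.[]

  private
    module P where
      open RawRing polyRing public
      open LinearAlgebra polyRing public
      open RawMagmaDefs (RawRing.*-rawMagma polyRing) public using (_∣_; _∤_)

  charPoly : ∀ {n} → Matrix Carrier n → Poly
  charPoly M = P.det λ i j →
    (X P.* P.identity i j) P.+ (P.- constant (M i j))

  IsSimpleRoot : Poly → Carrier → Set _
  IsSimpleRoot p t = (X-t P.∣ p) × ((X-t P.* X-t) P.∤ p)
    where
    X-t : Poly
    X-t = X P.+ (P.- constant t)

  IsSimpleEigenvalue : ∀ {n} → Matrix Carrier n → Carrier → Set _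
  IsSimpleEigenvalue M t = IsSimpleRoot (charPoly M) t

------------------------------------------------------------------------
-- Regular sequences

Sequence : Set
Sequence = ℕ → ℤ

toℚ : ℤ → ℚ
toℚ i = i ℚ./ 1

Kernel : ℕ → Sequence → Pred Sequence 0ℓ
Kernel k f g =
  ∃[ l ] ∃[ r ] r ℕ.< k ℕ.^ l × (∀ n → g n ≡ f (k ℕ.^ l ℕ.* n ℕ.+ r))

combination : ∀ {m} → Vector ℚ m → Vector (ℕ → ℚ) m → ℕ → ℚ
combination c gs n = sum λ i → c i ℚ.* gs i n
  where open LinearAlgebra ℚ.+-*-rawRing

ℚ-Span : Pred Sequence 0ℓ → Pred (ℕ → ℚ) 0ℓ
ℚ-Span P h =
  ∃[ m ] Σ[ gs ∈ Vector Sequence m ] Σ[ c ∈ Vector ℚ m ]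
    (∀ i → gs i ∈ P) × (h ≗ combination c (λ i n → toℚ (gs i n)))

IsFiniteDimensional : Pred (ℕ → ℚ) 0ℓ → Set
IsFiniteDimensional V =
  ∃[ m ] Σ[ gs ∈ Vector (ℕ → ℚ) m ]
    (∀ i → gs i ∈ V) × (∀ h → h ∈ V → ∃[ c ] h ≗ combination c gs)

IsRegular : ℕ → Sequence → Set
IsRegular k f = IsFiniteDimensional (ℚ-Span (Kernel k f))

record IsBasis {d : ℕ} (V : Pred (ℕ → ℚ) 0ℓ) (gs : Vector (ℕ → ℚ) d) : Set where
  field
    members     : ∀ i → gs i ∈ V
    independent : ∀ c → (∀ n → combination c gs n ≡ ℚ.0ℚ) → ∀ i → c i ≡ ℚ.0ℚ
    spanning    : ∀ h → h ∈ V → ∃[ c ] h ≗ combination c gs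

IsIntegerBasis : ∀ {d} → Pred (ℕ → ℚ) 0ℓ → Vector Sequence d → Set
IsIntegerBasis V fs = IsBasis V (λ i n → toℚ (fs i n))

AreDigitMatrices : ∀ {k d} → Vector Sequence d → Vector (Matrix ℤ d) k → Set
AreDigitMatrices {k} fs B =
  ∀ m (a : Fin k) → 𝐟 (k ℕ.* m ℕ.+ toℕ a) ≗ 𝐟 m ⊛ B a
  where
  open LinearAlgebra ℤ.+-*-rawRing
  𝐟 : ℕ → Vector ℤ _
  𝐟 n i = fs i n

digitSum : ∀ {k d} → Vector (Matrix ℤ d) k → Matrix ℤ d
digitSum = LinearAlgebra.sumᴹ ℤ.+-*-rawRing

------------------------------------------------------------------------
-- The real numbers

module Bounds {A : Set} (_≤_ : Rel A 0ℓ) where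

  IsUpperBound : Pred A 0ℓ → A → Set
  IsUpperBound P b = ∀ x → x ∈ P → x ≤ b

  IsLowerBound : Pred A 0ℓ → A → Set
  IsLowerBound P b = ∀ x → x ∈ P → b ≤ x

  IsSup : Pred A 0ℓ → A → Set
  IsSup P s = IsUpperBound P s × (∀ b → IsUpperBound P b → s ≤ b)

  IsInf : Pred A 0ℓ → A → Set
  IsInf P s = IsLowerBound P s × (∀ b → IsLowerBound P b → b ≤ s)

  IsMax : Pred A 0ℓ → A → Set
  IsMax P s = s ∈ P × IsUpperBound P s

-- The reals enter through their characterisation, unique up to
-- isomorphism, as an ordered field in which every nonempty set that is
-- bounded above has a supremum.  Inversion is total; 0# ⁻¹ is arbitrary.
record CompleteOrderedField : Set₁ where
  infix 4 _≤_
  infix 8 _⁻¹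
  field
    commutativeRing : CommutativeRing 0ℓ 0ℓ
  open CommutativeRing commutativeRing public
  field
    _≤_          : Rel Carrier 0ℓ
    isTotalOrder : IsTotalOrder _≈_ _≤_
    0≉1          : 0# ≉ 1#
    _⁻¹          : Carrier → Carrier
    ⁻¹-cong      : ∀ {x y} → x ≈ y → x ⁻¹ ≈ y ⁻¹
    ⁻¹-inverse   : ∀ {x} → x ≉ 0# → x * x ⁻¹ ≈ 1#
    +-monoˡ-≤    : ∀ {x y} z → x ≤ y → x + z ≤ y + z
    *-nonneg     : ∀ {x y} → 0# ≤ x → 0# ≤ y → 0# ≤ x * y
  open Bounds _≤_ public
  field
    complete     : ∀ P → Satisfiable P → ∃ (IsUpperBound P) → ∃ (IsSup P)

  totalOrder : TotalOrder 0ℓ 0ℓ 0ℓ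
  totalOrder = record { isTotalOrder = isTotalOrder }

  open NonStrictToStrict _≈_ _≤_ public using (_<_)
  open Max totalOrder public using (_⊔_)
  open VectorEquality setoid public using (_≋_)

------------------------------------------------------------------------
-- Analysis over the reals

module Analysis (R : CompleteOrderedField) where
  open CompleteOrderedField R
  open LinearAlgebra rawRing
  open Polynomials rawRing using (IsSimpleEigenvalue)
  open RawSemiringDefs (RawRing.rawSemiring rawRing) using ()
    renaming (_×_ to _×ℕ_)

  ℝ : Set
  ℝ = Carrier

  infix 4 _<ℝ_
  _<ℝ_ : Rel ℝ 0ℓ
  _<ℝ_ = _<_

  fromℕ : ℕ → ℝ
  fromℕ n = n ×ℕ 1#

  fromℤ : ℤ → ℝ
  fromℤ (+ n)      = fromℕ n
  fromℤ (-[1+ n ]) = - fromℕ (suc n)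

  realMatrix : ∀ {n} → Matrix ℤ n → Matrix ℝ n
  realMatrix M i j = fromℤ (M i j)

  ∣_∣ : ℝ → ℝ
  ∣ x ∣ = x ⊔ - x

  infixl 6 _⊕_ _⊖_

  _⊕_ : ∀ {n} → Vector ℝ n → Vector ℝ n → Vector ℝ n
  _⊕_ = Vector.zipWith _+_

  _⊖_ : ∀ {n} → Vector ℝ n → Vector ℝ n → Vector ℝ n
  _⊖_ = Vector.zipWith _-_

  normSquared : ∀ {n} → Vector ℝ n → ℝ
  normSquared x = sum λ i → x i * x i

  -- t = y^{1/n}, for y ≥ 0 and n ≥ 1
  IsRoot : ℕ → ℝ → ℝ → Set
  IsRoot n y t = 0# ≤ t × t ^ n ≈ y

  IsEuclideanNorm : ∀ {n} → Vector ℝ n → ℝ → Set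
  IsEuclideanNorm x t = IsRoot 2 (normSquared x) t

  IsOperatorNorm : ∀ {n} → Matrix ℝ n → ℝ → Set
  IsOperatorNorm M = IsSup λ t →
    ∃[ x ] (∃[ s ] IsEuclideanNorm x s × s ≤ 1#) × IsEuclideanNorm (M ∗ x) t

  -- Complex numbers are pairs (real part , imaginary part).

  complexRing : RawRing 0ℓ 0ℓ
  complexRing = record
    { Carrier = ℝ × ℝ
    ; _≈_     = λ (a , b) (c , d) → a ≈ c × b ≈ d
    ; _+_     = λ (a , b) (c , d) → (a + c , b + d)
    ; _*_     = λ (a , b) (c , d) → (a * c - b * d , a * d + b * c)
    ; -_      = λ (a , b) → (- a , - b)
    ; 0#      = (0# , 0#)
    ; 1#      = (1# , 0#)
    }

  open RawRing complexRing using ()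
    renaming (Carrier to ℂ; _≈_ to _≈ℂ_)

  fromℝ : ℝ → ℂ
  fromℝ x = (x , 0#)

  IsModulus : ℂ → ℝ → Set
  IsModulus (a , b) t = IsRoot 2 (a * a + b * b) t

  IsComplexEigenvalue : ∀ {n} → Matrix ℝ n → ℂ → Set
  IsComplexEigenvalue M =
    LinearAlgebra.IsEigenvalue complexRing (λ i j → fromℝ (M i j))

  IsSpectralRadius : ∀ {n} → Matrix ℝ n → ℝ → Set
  IsSpectralRadius M = IsMax λ t →
    ∃[ z ] IsComplexEigenvalue M z × IsModulus z t

  IsUniqueDominantEigenvalue : ∀ {n} → Matrix ℝ n → ℝ → Set
  IsUniqueDominantEigenvalue M r =
    IsSimpleEigenvalue M r ×
    (∀ z → IsComplexEigenvalue M z → ¬ (z ≈ℂ fromℝ r) →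
     ∀ t → IsModulus z t → t < r)

  IsLimSup : (ℕ → ℝ) → ℝ → Set
  IsLimSup u L =
    Σ[ s ∈ (ℕ → ℝ) ] (∀ N → IsSup (λ t → ∃[ n ] N ℕ.≤ n × t ≈ u n) (s N)) ×
           IsInf (λ t → ∃[ N ] t ≈ s N) L

  wordProduct : ∀ {k n l} → Vector (Matrix ℝ n) k → Vector (Fin k) l → Matrix ℝ n
  wordProduct B w = Vector.foldr _·_ identity λ i → B (w i)

  -- The sequence starts at word length 1, since the 0-th root is undefined.
  IsJointSpectralRadius : ∀ {k n} → Vector (Matrix ℝ n) k → ℝ → Set
  IsJointSpectralRadius {k} B L =
    ∃[ u ] (∀ l → IsMax (rootNorms (suc l)) (u l)) × IsLimSup u L
    where
    rootNorms : ℕ → Pred ℝ 0ℓ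
    rootNorms l t =
      Σ[ w ∈ Vector (Fin k) l ]
      ∃[ c ] IsOperatorNorm (wordProduct B w) c × IsRoot l c t

  -- The open Euclidean ball of radius ε, for ε > 0
  Ball : ∀ {n} → Vector ℝ n → ℝ → Pred (Vector ℝ n) 0ℓ
  Ball x ε y = normSquared (y ⊖ x) < ε * ε

  IsContinuous : ∀ {n} → (ℝ → Vector ℝ n) → Set
  IsContinuous F =
    ∀ x ε → 0# < ε → ∃[ δ ] 0# < δ ×
      (∀ y → ∣ y - x ∣ < δ → F y ∈ Ball (F x) ε)

  IsOpen : ∀ {n} → Pred (Vector ℝ n) 0ℓ → Set
  IsOpen U = ∀ x → x ∈ U → ∃[ ε ] 0# < ε × Ball x ε ⊆ U

  IsCompact : ∀ {n} → Pred (Vector ℝ n) 0ℓ → Set₁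
  IsCompact {n} K =
    ∀ (I : Set) (U : I → Pred (Vector ℝ n) 0ℓ) → (∀ i → IsOpen (U i)) →
    K ⊆ ⋃[ i ∶ I ] U i →
    Σ[ is ∈ List I ] (∀ {x} → x ∈ K → Any (λ i → x ∈ U i) is)

  Image : ∀ {m n} → (Vector ℝ m → Vector ℝ n) →
          Pred (Vector ℝ m) 0ℓ → Pred (Vector ℝ n) 0ℓ
  Image S P q = ∃[ p ] p ∈ P × S p ≋ q

  ----------------------------------------------------------------------
  -- Self-affine sets

  record IsNorm {n : ℕ} (N : Vector ℝ n → ℝ) : Set where
    field
      cong        : ∀ {x y} → x ≋ y → N x ≈ N y
      nonneg      : ∀ x → 0# ≤ N x
      definite    : ∀ x → N x ≈ 0# → x ≋ Vector.replicate n 0#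
      homogeneous : ∀ t x → N (t ∙ x) ≈ ∣ t ∣ * N x
      triangle    : ∀ x y → N (x ⊕ y) ≤ N x + N y

  IsAffine : ∀ {n} → (Vector ℝ n → Vector ℝ n) → Set
  IsAffine S = ∃[ A ] ∃[ b ] (∀ x → S x ≋ (A ∗ x) ⊕ b)

  IsContraction : ∀ {n} → (Vector ℝ n → ℝ) → (Vector ℝ n → Vector ℝ n) → Set
  IsContraction N S =
    ∃[ c ] 0# ≤ c × c < 1# × (∀ x y → N (S x ⊖ S y) ≤ c * N (x ⊖ y))

  -- Contraction is with respect to some norm common to all the maps:
  -- linear parts of joint spectral radius below one need not contract
  -- Euclidean distance.
  record IsSelfAffineAttractor {k n : ℕ}
         (S : Vector (Vector ℝ n → Vector ℝ n) k)
         (K : Pred (Vector ℝ n) 0ℓ) : Set₁ where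
    field
      atLeastTwo  : 2 ℕ.≤ k
      affine      : ∀ j → IsAffine (S j)
      contractive : ∃[ N ] IsNorm N × (∀ j → IsContraction N (S j))
      nonempty    : Satisfiable K
      compact     : IsCompact K
      invariant   : K ≐ ⋃[ j ∶ Fin k ] Image (S j) K
      unique      : ∀ L → Satisfiable L → IsCompact L →
                    L ≐ ⋃[ j ∶ Fin k ] Image (S j) L → L ≐ K

  ----------------------------------------------------------------------
  -- The dilation equation and its iterated function system

  record IsDilationSolution {k n : ℕ} (B : Vector (Matrix ℝ n) k) (ρ : ℝ)
         (v : Vector ℝ n) (F : ℝ → Vector ℝ n) : Set where
    field
      continuous : IsContinuous F
      dilation   : ∀ x → F x ≋
        sumⱽ λ a → ρ ⁻¹ ∙ (B a ∗ F (fromℕ k * x - fromℕ (toℕ a)))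
      atMost0    : ∀ x → x ≤ 0# → F x ≋ Vector.replicate n 0#
      atLeast1   : ∀ x → 1# ≤ x → F x ≋ v

  -- ℝ^{n+1} is split as y = (y₀ , 𝐲) = (head y , tail y).
  -- The index a of the sum ranges over Fin′ j, that is, 0 ≤ a < j.
  ifs : ∀ {k n} → Vector (Matrix ℝ n) k → ℝ → Vector ℝ n →
        Vector (Vector ℝ (suc n) → Vector ℝ (suc n)) k
  ifs {k} B ρ v j y =
    ((head y + fromℕ (toℕ j)) * fromℕ k ⁻¹) ∷
    ((ρ ⁻¹ ∙ (B j ∗ tail y)) ⊕
     sumⱽ {toℕ j} λ a → ρ ⁻¹ ∙ (B (inject {i = j} a) ∗ v))

  Graph : ∀ {n} → (ℝ → Vector ℝ n) → Pred (Vector ℝ (suc n)) 0ℓ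
  Graph F p = ∃[ x ] 0# ≤ x × x ≤ 1# × p ≋ x ∷ F x

{-# OPTIONS --safe #-}

-- Since ρ exceeds the joint spectral radius, all sufficiently long products of
-- the matrices ρ⁻¹ B_j are small; taking the maximum of the ℓ¹ norm over the
-- short products gives a norm which every ρ⁻¹ B_j contracts, and adding |y₀|
-- makes all S_j contractions for one norm on ℝ^{d+1}.  The dilation equation at
-- (x + j) / k says that S_j (x , F x) is the point of the graph over (x + j) / k,
-- whence the invariance.  If K and L are compact and invariant, m-fold
-- application of the S_j brings each point of K within cᵐ D of L, so K ⊆ L
-- because L is closed; by symmetry the attractor is unique.
module Submission where

open import Level using (0ℓ)
import Algebra.Construct.NaturalChoice.Max as Max
import Algebra.Properties.AbelianGroup as AbelianGroupProperties
import Algebra.Properties.Ring as RingProperties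
import Algebra.Properties.Semiring.Exp as Exp
import Algebra.Properties.Semiring.Mult.TCOptimised as Mult
import Algebra.Properties.Semiring.Sum as Sum
import Algebra.Solver.Ring as RingSolver
open import Algebra.Bundles using (CommutativeRing)
open import Algebra.Solver.Ring.AlmostCommutativeRing
  using (fromCommutativeRing; _-Raw-AlmostCommutative⟶_)
open import Axiom.ExcludedMiddle using (ExcludedMiddle)
open import Data.Empty using (⊥-elim)
open import Data.Fin.Base using (Fin; zero; suc; toℕ; inject)
import Data.Fin.Properties as Fin
open import Data.Integer.Base as ℤ using (ℤ; +_; -[1+_]; _◃_; sign)
import Data.Integer.Properties as ℤ
open import Data.List.Base as List using (List)
open import Data.List.Relation.Unary.Any as Any using (Any; here; there)
open import Data.Maybe.Base using (Maybe; just; nothing)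
open import Data.Nat.Base as ℕ using (ℕ; zero; suc)
import Data.Nat.Properties as ℕ
open import Data.Product.Base using (Σ-syntax; ∃-syntax; _×_; _,_; proj₁; proj₂)
open import Data.Sign.Base as Sign using (Sign)
open import Data.Sum.Base using (_⊎_; inj₁; inj₂)
open import Data.Vec.Functional as Vector using (Vector; _∷_; head; tail)
open import Function.Base using (_∘_)
open import Relation.Binary.Bundles using (TotalOrder)
import Relation.Binary.Construct.NonStrictToStrict as NonStrictToStrict
open import Relation.Binary.PropositionalEquality as ≡ using (_≡_; _≗_)
import Relation.Binary.Reasoning.PartialOrder as ≤-Reasoning
import Relation.Binary.Reasoning.Setoid as ≈-Reasoning
open import Relation.Nullary using (¬_; Dec; yes; no)
open import Relation.Unary using (Pred; _∈_; _⊆_; _≐_; Satisfiable; ⋃)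
open import Defs

-- The joint spectral radius is defined through roots of Euclidean operator norms, and it bounds
-- only such roots as exist. Before the hypothesis on ρ says anything about a given word, the
-- operator norm of its product and the root of that norm must be constructed, both from
-- completeness. Passing between Euclidean and ℓ¹ norms costs a factor equal to the dimension; a
-- number q strictly between a tail supremum and ρ absorbs it, since the ratio of the two geometric
-- rates decays. What remains controls words of one fixed length only and says nothing about a
-- single matrix, which is why a new norm has to be built.
--
-- The second obstacle is that sets are arbitrary predicates over a setoid and compactness means
-- open covers. Membership need not be stable under `_≋_`, and boundedness, closedness and the
-- compactness of [0, 1] are each extracted from a suitable cover or supremum.

-- The ring solver needs coefficients with decidable equality, which an abstract
-- ring lacks; hence the interpretation of ℤ.
module IntegerCoefficients {c ℓ} (R : CommutativeRing c ℓ) where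
  open CommutativeRing R
  open AbelianGroupProperties +-abelianGroup using (⁻¹-∙-comm)
  open RingProperties ring
  open Mult semiring renaming (_×_ to _×ℕ_)
  open ≈-Reasoning setoid

  ⟦_⟧ℤ : ℤ → Carrier
  ⟦ + n ⟧ℤ      = n ×ℕ 1#
  ⟦ -[1+ n ] ⟧ℤ = - (suc n ×ℕ 1#)

  private
    -- Multiplication of integers is defined by signs and absolute values, so its homomorphism law
    -- is proved through this decomposition.
    signed : Sign → Carrier → Carrier
    signed Sign.+ x = x
    signed Sign.- x = - x

    cancel : ∀ x y z → (x + y) - (x + z) ≈ y - z
    cancel x y z = begin
      (x + y) - (x + z)       ≈⟨ +-congˡ (⁻¹-∙-comm x z) ⟨
      (x + y) + (- x - z)     ≈⟨ +-congʳ (+-comm x y) ⟩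
      (y + x) + (- x - z)     ≈⟨ +-assoc y x _ ⟩
      y + (x + (- x - z))     ≈⟨ +-congˡ (+-assoc x (- x) (- z)) ⟨
      y + ((x - x) - z)       ≈⟨ +-congˡ (+-congʳ (-‿inverseʳ x)) ⟩
      y + (0# - z)            ≈⟨ +-congˡ (+-identityˡ (- z)) ⟩
      y - z                   ∎

    ⊖-homo : ∀ m n → ⟦ m ℤ.⊖ n ⟧ℤ ≈ m ×ℕ 1# - n ×ℕ 1#
    ⊖-homo m zero = sym (trans (+-congˡ -0#≈0#) (+-identityʳ _))
    ⊖-homo zero (suc n) = sym (+-identityˡ _)
    ⊖-homo (suc m) (suc n) = begin
      ⟦ suc m ℤ.⊖ suc n ⟧ℤ               ≡⟨ ≡.cong ⟦_⟧ℤ (ℤ.[1+m]⊖[1+n]≡m⊖n m n) ⟩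
      ⟦ m ℤ.⊖ n ⟧ℤ                       ≈⟨ ⊖-homo m n ⟩
      m ×ℕ 1# - n ×ℕ 1#                  ≈⟨ cancel 1# _ _ ⟨
      (1# + m ×ℕ 1#) - (1# + n ×ℕ 1#)    ≈⟨ +-cong (1+× m 1#) (-‿cong (1+× n 1#)) ⟨
      suc m ×ℕ 1# - suc n ×ℕ 1#          ∎

    +-homo : ∀ i j → ⟦ i ℤ.+ j ⟧ℤ ≈ ⟦ i ⟧ℤ + ⟦ j ⟧ℤ
    +-homo (+ m)      (+ n)      = ×-homo-+ 1# m n
    +-homo (+ m)      (-[1+ n ]) = ⊖-homo m (suc n)
    +-homo (-[1+ m ]) (+ n)      = trans (⊖-homo n (suc m)) (+-comm _ _)
    +-homo (-[1+ m ]) (-[1+ n ]) = begin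
      - (suc (suc (m ℕ.+ n)) ×ℕ 1#)        ≡⟨ ≡.cong (λ l → - (l ×ℕ 1#)) (≡.cong suc (ℕ.+-suc m n)) ⟨
      - ((suc m ℕ.+ suc n) ×ℕ 1#)          ≈⟨ -‿cong (×-homo-+ 1# (suc m) (suc n)) ⟩
      - (suc m ×ℕ 1# + suc n ×ℕ 1#)         ≈⟨ ⁻¹-∙-comm _ _ ⟨
      - (suc m ×ℕ 1#) + - (suc n ×ℕ 1#)     ∎

    ◃-homo : ∀ s n → ⟦ s ◃ n ⟧ℤ ≈ signed s (n ×ℕ 1#)
    ◃-homo Sign.+ zero    = refl
    ◃-homo Sign.- zero    = sym -0#≈0#
    ◃-homo Sign.+ (suc n) = refl
    ◃-homo Sign.- (suc n) = refl

    signed-* : ∀ s t x y → signed (s Sign.* t) (x * y) ≈ signed s x * signed t y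
    signed-* Sign.+ Sign.+ x y = refl
    signed-* Sign.+ Sign.- x y = -‿distribʳ-* x y
    signed-* Sign.- Sign.+ x y = -‿distribˡ-* x y
    signed-* Sign.- Sign.- x y = begin
      x * y       ≈⟨ -‿involutive _ ⟨
      - - (x * y) ≈⟨ -‿cong (-‿distribʳ-* x y) ⟩
      - (x * - y) ≈⟨ -‿distribˡ-* x (- y) ⟩
      - x * - y   ∎

    signed-cong : ∀ s {x y} → x ≈ y → signed s x ≈ signed s y
    signed-cong Sign.+ x≈y = x≈y
    signed-cong Sign.- x≈y = -‿cong x≈y

    ⟦⟧-signed : ∀ i → signed (sign i) (ℤ.∣ i ∣ ×ℕ 1#) ≈ ⟦ i ⟧ℤ
    ⟦⟧-signed (+ n)      = refl
    ⟦⟧-signed (-[1+ n ]) = refl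

    *-homo : ∀ i j → ⟦ i ℤ.* j ⟧ℤ ≈ ⟦ i ⟧ℤ * ⟦ j ⟧ℤ
    *-homo i j = begin
      ⟦ s Sign.* t ◃ m ℕ.* n ⟧ℤ                 ≈⟨ ◃-homo (s Sign.* t) (m ℕ.* n) ⟩
      signed (s Sign.* t) ((m ℕ.* n) ×ℕ 1#)      ≈⟨ signed-cong (s Sign.* t) (×1-homo-* m n) ⟩
      signed (s Sign.* t) (m ×ℕ 1# * (n ×ℕ 1#))   ≈⟨ signed-* s t _ _ ⟩
      signed s (m ×ℕ 1#) * signed t (n ×ℕ 1#)     ≈⟨ *-cong (⟦⟧-signed i) (⟦⟧-signed j) ⟩
      ⟦ i ⟧ℤ * ⟦ j ⟧ℤ                           ∎
      where
      s = sign i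
      t = sign j
      m = ℤ.∣ i ∣
      n = ℤ.∣ j ∣

    -‿homo : ∀ i → ⟦ ℤ.- i ⟧ℤ ≈ - ⟦ i ⟧ℤ
    -‿homo (+ zero)  = sym -0#≈0#
    -‿homo ℤ.+[1+ n ] = refl
    -‿homo -[1+ n ]  = sym (-‿involutive _)

    morphism : ℤ.+-*-rawRing -Raw-AlmostCommutative⟶ fromCommutativeRing R
    morphism = record
      { ⟦_⟧    = ⟦_⟧ℤ
      ; +-homo = +-homo
      ; *-homo = *-homo
      ; -‿homo = -‿homo
      ; 0-homo = refl
      ; 1-homo = refl
      }

    _≟?_ : ∀ i j → Maybe (⟦ i ⟧ℤ ≈ ⟦ j ⟧ℤ)
    i ≟? j with i ℤ.≟ j
    ... | yes i≡j = just (reflexive (≡.cong ⟦_⟧ℤ i≡j))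
    ... | no  _   = nothing

  open RingSolver ℤ.+-*-rawRing (fromCommutativeRing R) morphism _≟?_ public
    using (solve; _:=_; _:+_; _:*_; _:-_; :-_; con; Polynomial)

  :0 :1 : ∀ {n} → Polynomial n
  :0 = con ℤ.0ℤ
  :1 = con ℤ.1ℤ

-- Arithmetic of order, absolute values, sums, maxima and powers in a complete ordered field.

module OrderedFieldProperties (em : ExcludedMiddle 0ℓ) (R : CompleteOrderedField) where
  open CompleteOrderedField R hiding (zero)
  open Analysis R
  open LinearAlgebra rawRing
  open IntegerCoefficients commutativeRing public
  open AbelianGroupProperties +-abelianGroup public using (x∙y⁻¹≈ε⇒x≈y)
  open TotalOrder totalOrder public using (antisym; total; poset; ≤-respˡ-≈; ≤-respʳ-≈)
    renaming (refl to ≤-refl; trans to ≤-trans; reflexive to ≤-reflexive)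
  open NonStrictToStrict _≈_ _≤_ public using (<⇒≤)
  module ≤R = ≤-Reasoning poset
  open Max totalOrder public using (⊔-cong; ⊔-sel; ⊔-lub; x≤x⊔y; x≤y⊔x)

  opaque
    <⇒≱ : ∀ {x y} → x < y → ¬ y ≤ x
    <⇒≱ = NonStrictToStrict.<⇒≱ _≈_ _≤_ antisym

    ≰⇒> : ∀ {x y} → ¬ x ≤ y → y < x
    ≰⇒> = NonStrictToStrict.≰⇒> _≈_ _≤_ sym ≤-reflexive total

    _≤?_ : ∀ x y → Dec (x ≤ y)
    _ ≤? _ = em

    ≮⇒≥ : ∀ {x y} → ¬ x < y → y ≤ x
    ≮⇒≥ = NonStrictToStrict.≮⇒≥ _≈_ _≤_ sym (λ _ _ → em) ≤-reflexive total

    <-≤-trans : ∀ {x y z} → x < y → y ≤ z → x < z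
    <-≤-trans = NonStrictToStrict.<-≤-trans _≈_ _≤_ sym ≤-trans antisym ≤-respʳ-≈

    ≤-<-trans : ∀ {x y z} → x ≤ y → y < z → x < z
    ≤-<-trans = NonStrictToStrict.≤-<-trans _≈_ _≤_ ≤-trans antisym ≤-respˡ-≈

    ≤-or-> : ∀ x y → x ≤ y ⊎ y < x
    ≤-or-> x y with x ≤? y
    ... | yes x≤y = inj₁ x≤y
    ... | no  x≰y = inj₂ (≰⇒> x≰y)

    0≤⇒0≈⊎0< : ∀ {x} → 0# ≤ x → 0# ≈ x ⊎ 0# < x
    0≤⇒0≈⊎0< {x} 0≤x with em {0# ≈ x}
    ... | yes 0≈x = inj₁ 0≈x
    ... | no  0≉x = inj₂ (0≤x , 0≉x)

    -- Most inequalities below are proved by exhibiting the difference of the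
    -- two sides as an expression that is visibly nonnegative.
    ≤-by : ∀ {x y} d → 0# ≤ d → y ≈ x + d → x ≤ y
    ≤-by {x} {y} d 0≤d y≈x+d = begin
      x       ≈⟨ +-identityˡ x ⟨
      0# + x  ≤⟨ +-monoˡ-≤ x 0≤d ⟩
      d + x   ≈⟨ +-comm d x ⟩
      x + d   ≈⟨ y≈x+d ⟨
      y       ∎
      where open ≤R

    0≤y-x : ∀ {x y} → x ≤ y → 0# ≤ y - x
    0≤y-x {x} x≤y = ≤-respˡ-≈ (-‿inverseʳ x) (+-monoˡ-≤ (- x) x≤y)

    <-by : ∀ {x y} d → 0# < d → y ≈ x + d → x < y
    <-by {x} d (0≤d , 0≉d) y≈x+d =
      ≤-by d 0≤d y≈x+d , λ x≈y → 0≉d (begin-equality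
        0#         ≈⟨ -‿inverseʳ x ⟨
        x - x      ≈⟨ +-congʳ (trans x≈y y≈x+d) ⟩
        x + d - x  ≈⟨ solve 2 (λ x d → x :+ d :- x := d) refl x d ⟩
        d          ∎)
      where open ≤R

    0<y-x : ∀ {x y} → x < y → 0# < y - x
    0<y-x {x} {y} (x≤y , x≉y) =
      0≤y-x x≤y , λ 0≈y-x → x≉y (sym (x∙y⁻¹≈ε⇒x≈y y x (sym 0≈y-x)))

    +-mono-≤ : ∀ {x y u v} → x ≤ y → u ≤ v → x + u ≤ y + v
    +-mono-≤ {x} {y} {u} {v} x≤y u≤v = begin
      x + u  ≤⟨ +-monoˡ-≤ u x≤y ⟩
      y + u  ≈⟨ +-comm y u ⟩
      u + y  ≤⟨ +-monoˡ-≤ y u≤v ⟩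
      v + y  ≈⟨ +-comm v y ⟩
      y + v  ∎
      where open ≤R

    +-nonneg : ∀ {x y} → 0# ≤ x → 0# ≤ y → 0# ≤ x + y
    +-nonneg 0≤x 0≤y = ≤-respˡ-≈ (+-identityˡ 0#) (+-mono-≤ 0≤x 0≤y)

    +-pos : ∀ {x y} → 0# < x → 0# ≤ y → 0# < x + y
    +-pos {x} {y} 0<x 0≤y = <-≤-trans 0<x (≤-by y 0≤y refl)

    <-+ : ∀ {x d} → 0# < d → x < x + d
    <-+ {d = d} 0<d = <-by d 0<d refl

    +-mono-< : ∀ {x y u v} → x < y → u ≤ v → x + u < y + v
    +-mono-< {x} {y} {u} {v} x<y u≤v = <-by _ (+-pos (0<y-x x<y) (0≤y-x u≤v))
      (solve 4 (λ x y u v → y :+ v := (x :+ u) :+ ((y :- x) :+ (v :- u))) refl x y u v)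

    *-monoˡ-≤ : ∀ {x y} z → 0# ≤ z → x ≤ y → z * x ≤ z * y
    *-monoˡ-≤ {x} {y} z 0≤z x≤y = ≤-by _ (*-nonneg 0≤z (0≤y-x x≤y))
      (solve 3 (λ x y z → z :* y := z :* x :+ z :* (y :- x)) refl x y z)

    *-mono-≤ : ∀ {x y u v} → 0# ≤ x → x ≤ y → 0# ≤ u → u ≤ v → x * u ≤ y * v
    *-mono-≤ {x} {y} {u} {v} 0≤x x≤y 0≤u u≤v = begin
      x * u  ≤⟨ *-monoˡ-≤ x 0≤x u≤v ⟩
      x * v  ≈⟨ *-comm x v ⟩
      v * x  ≤⟨ *-monoˡ-≤ v (≤-trans 0≤u u≤v) x≤y ⟩
      v * y  ≈⟨ *-comm v y ⟩
      y * v  ∎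
      where open ≤R

    0≤x² : ∀ x → 0# ≤ x * x
    0≤x² x with total 0# x
    ... | inj₁ 0≤x = *-nonneg 0≤x 0≤x
    ... | inj₂ x≤0 = ≤-respʳ-≈ (solve 1 (λ x → (:0 :- x) :* (:0 :- x) := x :* x) refl x)
                       (*-nonneg (0≤y-x x≤0) (0≤y-x x≤0))

    0<1 : 0# < 1#
    0<1 = ≤-respʳ-≈ (*-identityˡ 1#) (0≤x² 1#) , 0≉1

    *-cancelˡ-0 : ∀ {x y} → x ≉ 0# → 0# ≈ x * y → 0# ≈ y
    *-cancelˡ-0 {x} {y} x≉0 0≈xy = begin-equality
      0#               ≈⟨ zeroʳ (x ⁻¹) ⟨
      x ⁻¹ * 0#        ≈⟨ *-congˡ 0≈xy ⟩
      x ⁻¹ * (x * y)   ≈⟨ solve 3 (λ x y z → z :* (x :* y) := x :* z :* y) refl x y (x ⁻¹) ⟩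
      x * x ⁻¹ * y     ≈⟨ *-congʳ (⁻¹-inverse x≉0) ⟩
      1# * y           ≈⟨ *-identityˡ y ⟩
      y                ∎
      where open ≤R

    0<⇒≉0 : ∀ {x} → 0# < x → x ≉ 0#
    0<⇒≉0 (_ , 0≉x) x≈0 = 0≉x (sym x≈0)

    *-pos : ∀ {x y} → 0# < x → 0# < y → 0# < x * y
    *-pos 0<x@(0≤x , _) (0≤y , 0≉y) =
      *-nonneg 0≤x 0≤y , λ 0≈xy → 0≉y (*-cancelˡ-0 (0<⇒≉0 0<x) 0≈xy)

    x*x⁻¹≈1 : ∀ {x} → 0# < x → x * x ⁻¹ ≈ 1#
    x*x⁻¹≈1 0<x = ⁻¹-inverse (0<⇒≉0 0<x)

    ⁻¹-pos : ∀ {x} → 0# < x → 0# < x ⁻¹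
    ⁻¹-pos {x} 0<x@(0≤x , _) = ≰⇒> λ x⁻¹≤0 → <⇒≱ 0<1 (begin
      1#          ≈⟨ x*x⁻¹≈1 0<x ⟨
      x * x ⁻¹    ≤⟨ *-monoˡ-≤ x 0≤x x⁻¹≤0 ⟩
      x * 0#      ≈⟨ zeroʳ x ⟩
      0#          ∎)
      where open ≤R

    *-monoˡ-< : ∀ {x y} z → 0# < z → x < y → z * x < z * y
    *-monoˡ-< {x} {y} z 0<z x<y = <-by _ (*-pos 0<z (0<y-x x<y))
      (solve 3 (λ x y z → z :* y := z :* x :+ z :* (y :- x)) refl x y z)

    *-cancelˡ-≤ : ∀ {x y} z → 0# < z → z * x ≤ z * y → x ≤ y
    *-cancelˡ-≤ z 0<z zx≤zy = ≮⇒≥ λ y<x → <⇒≱ (*-monoˡ-< z 0<z y<x) zx≤zy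

  ½ : ℝ
  ½ = (1# + 1#) ⁻¹

  opaque
    0<½ : 0# < ½
    0<½ = ⁻¹-pos (+-pos 0<1 (<⇒≤ 0<1))

    ½+½≈1 : ½ + ½ ≈ 1#
    ½+½≈1 = trans (solve 1 (λ h → h :+ h := (:1 :+ :1) :* h) refl ½)
                  (x*x⁻¹≈1 (+-pos 0<1 (<⇒≤ 0<1)))

    *-monoʳ-≤ : ∀ {x y z} → 0# ≤ z → x ≤ y → x * z ≤ y * z
    *-monoʳ-≤ {x} {y} {z} 0≤z x≤y = ≤-by _ (*-nonneg (0≤y-x x≤y) 0≤z)
      (solve 3 (λ x y z → y :* z := x :* z :+ (y :- x) :* z) refl x y z)

    x/y<1 : ∀ {x y} → 0# < y → x < y → x * y ⁻¹ < 1#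
    x/y<1 {x} {y} 0<y x<y = <-by _ (*-pos (0<y-x x<y) (⁻¹-pos 0<y)) (begin-equality
      1#                                ≈⟨ x*x⁻¹≈1 0<y ⟨
      y * y ⁻¹                          ≈⟨ solve 3 (λ x y i → y :* i := x :* i :+ (y :- x) :* i) refl x y (y ⁻¹) ⟩
      x * y ⁻¹ + (y - x) * y ⁻¹         ∎)
      where open ≤R

    half+half : ∀ x → ½ * x + ½ * x ≈ x
    half+half x = begin-equality
      ½ * x + ½ * x  ≈⟨ distribʳ x ½ ½ ⟨
      (½ + ½) * x    ≈⟨ *-congʳ ½+½≈1 ⟩
      1# * x         ≈⟨ *-identityˡ x ⟩
      x              ∎
      where open ≤R

    half-< : ∀ {x} → 0# < x → ½ * x < x
    half-< {x} 0<x = <-by _ (*-pos 0<½ 0<x) (sym (half+half x))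

    between : ∀ {x y} → x < y → ∃[ z ] x < z × z < y
    between {x} {y} x<y = x + ½ * (y - x)
      , <-+ 0<½d
      , <-by _ 0<½d (begin-equality
          y                                   ≈⟨ solve 2 (λ x y → y := x :+ (y :- x)) refl x y ⟩
          x + (y - x)                         ≈⟨ +-congˡ (half+half (y - x)) ⟨
          x + (½ * (y - x) + ½ * (y - x))     ≈⟨ +-assoc _ _ _ ⟨
          x + ½ * (y - x) + ½ * (y - x)       ∎)
      where
      open ≤R
      0<½d : 0# < ½ * (y - x)
      0<½d = *-pos 0<½ (0<y-x x<y)

    min₂ : ∀ {x y} → 0# < x → 0# < y → ∃[ z ] 0# < z × z ≤ x × z ≤ y
    min₂ {x} {y} 0<x 0<y with total x y
    ... | inj₁ x≤y = x , 0<x , ≤-refl , x≤y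
    ... | inj₂ y≤x = y , 0<y , y≤x , ≤-refl

    ≤-ε⇒≤ : ∀ {x y} → (∀ ε → 0# < ε → x ≤ y + ε) → x ≤ y
    ≤-ε⇒≤ {x} {y} h = ≮⇒≥ λ y<x → let (z , y<z , z<x) = between y<x in
      <⇒≱ z<x (≤-respʳ-≈ (solve 2 (λ y z → y :+ (z :- y) := z) refl y z)
        (h (z - y) (0<y-x y<z)))

    x²≤y²⇒x≤y : ∀ {x y} → 0# ≤ y → x * x ≤ y * y → x ≤ y
    x²≤y²⇒x≤y {x} {y} 0≤y x²≤y² = ≮⇒≥ λ y<x →
      <⇒≱ (<-by ((x - y) * (x + y))
            (*-pos (0<y-x y<x) (<-≤-trans (≤-<-trans 0≤y y<x) (≤-by y 0≤y refl)))
            (solve 2 (λ x y → x :* x := y :* y :+ (x :- y) :* (x :+ y)) refl x y))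
          x²≤y²

    x²<y²⇒x<y : ∀ {x y} → 0# ≤ y → x * x < y * y → x < y
    x²<y²⇒x<y {x} {y} 0≤y (x²≤y² , x²≉y²) =
      x²≤y²⇒x≤y 0≤y x²≤y² , λ x≈y → x²≉y² (*-cong x≈y x≈y)

    ∣∣-cong : ∀ {x y} → x ≈ y → ∣ x ∣ ≈ ∣ y ∣
    ∣∣-cong x≈y = ⊔-cong x≈y (-‿cong x≈y)

    x≤∣x∣ : ∀ x → x ≤ ∣ x ∣
    x≤∣x∣ x = x≤x⊔y x (- x)

    -x≤∣x∣ : ∀ x → - x ≤ ∣ x ∣
    -x≤∣x∣ x = x≤y⊔x x (- x)

    ∣x∣≤ : ∀ {x b} → x ≤ b → - x ≤ b → ∣ x ∣ ≤ b
    ∣x∣≤ = ⊔-lub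

    ⊔-lub-< : ∀ {x y b} → x < b → y < b → x ⊔ y < b
    ⊔-lub-< {x} {y} x<b y<b with ⊔-sel x y
    ... | inj₁ x⊔y≈x = ≤-<-trans (≤-reflexive x⊔y≈x) x<b
    ... | inj₂ x⊔y≈y = ≤-<-trans (≤-reflexive x⊔y≈y) y<b

    ∣x∣< : ∀ {x b} → x < b → - x < b → ∣ x ∣ < b
    ∣x∣< = ⊔-lub-<

    0≤x⇒∣x∣≈x : ∀ {x} → 0# ≤ x → ∣ x ∣ ≈ x
    0≤x⇒∣x∣≈x {x} 0≤x = antisym
      (∣x∣≤ ≤-refl (≤-by _ (+-nonneg 0≤x 0≤x) (solve 1 (λ x → x := :- x :+ (x :+ x)) refl x)))
      (x≤∣x∣ x)

    ∣-x∣≈∣x∣ : ∀ x → ∣ - x ∣ ≈ ∣ x ∣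
    ∣-x∣≈∣x∣ x = antisym
      (∣x∣≤ (-x≤∣x∣ x) (≤-respˡ-≈ (sym neg²) (x≤∣x∣ x)))
      (∣x∣≤ (≤-respˡ-≈ neg² (-x≤∣x∣ (- x))) (x≤∣x∣ (- x)))
      where
      neg² : - - x ≈ x
      neg² = solve 1 (λ x → :- (:- x) := x) refl x

    ∣∣-sign : ∀ x → (0# ≤ x × ∣ x ∣ ≈ x) ⊎ (0# ≤ - x × ∣ x ∣ ≈ - x)
    ∣∣-sign x with total 0# x
    ... | inj₁ 0≤x = inj₁ (0≤x , 0≤x⇒∣x∣≈x 0≤x)
    ... | inj₂ x≤0 = inj₂ (0≤-x , trans (sym (∣-x∣≈∣x∣ x)) (0≤x⇒∣x∣≈x 0≤-x))
      where
      0≤-x : 0# ≤ - x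
      0≤-x = ≤-respʳ-≈ (+-identityˡ (- x)) (0≤y-x x≤0)

    0≤∣x∣ : ∀ x → 0# ≤ ∣ x ∣
    0≤∣x∣ x with ∣∣-sign x
    ... | inj₁ (0≤x , ∣x∣≈x) = ≤-respʳ-≈ (sym ∣x∣≈x) 0≤x
    ... | inj₂ (0≤x , ∣x∣≈x) = ≤-respʳ-≈ (sym ∣x∣≈x) 0≤x

    ∣x∣²≈x² : ∀ x → ∣ x ∣ * ∣ x ∣ ≈ x * x
    ∣x∣²≈x² x with ∣∣-sign x
    ... | inj₁ (_ , ∣x∣≈x) = *-cong ∣x∣≈x ∣x∣≈x
    ... | inj₂ (_ , ∣x∣≈-x) = trans (*-cong ∣x∣≈-x ∣x∣≈-x)
            (solve 1 (λ x → :- x :* :- x := x :* x) refl x)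

    ∣x∣≈0⇒x≈0 : ∀ {x} → ∣ x ∣ ≈ 0# → x ≈ 0#
    ∣x∣≈0⇒x≈0 {x} ∣x∣≈0 with ∣∣-sign x
    ... | inj₁ (_ , ∣x∣≈x) = trans (sym ∣x∣≈x) ∣x∣≈0
    ... | inj₂ (_ , ∣x∣≈-x) = begin-equality
      x        ≈⟨ solve 1 (λ x → x := :- (:- x)) refl x ⟩
      - - x    ≈⟨ -‿cong (trans (sym ∣x∣≈-x) ∣x∣≈0) ⟩
      - 0#     ≈⟨ solve 0 (:- :0 := :0) refl ⟩
      0#       ∎
      where open ≤R

    -- Both sides are nonnegative and have the same square, which avoids a case distinction on the
    -- two signs.
    ∣xy∣≈∣x∣∣y∣ : ∀ x y → ∣ x * y ∣ ≈ ∣ x ∣ * ∣ y ∣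
    ∣xy∣≈∣x∣∣y∣ x y = antisym
      (x²≤y²⇒x≤y (*-nonneg (0≤∣x∣ x) (0≤∣x∣ y)) (≤-reflexive squares))
      (x²≤y²⇒x≤y (0≤∣x∣ (x * y)) (≤-reflexive (sym squares)))
      where
      open ≤R
      squares : ∣ x * y ∣ * ∣ x * y ∣ ≈ (∣ x ∣ * ∣ y ∣) * (∣ x ∣ * ∣ y ∣)
      squares = begin-equality
        ∣ x * y ∣ * ∣ x * y ∣              ≈⟨ ∣x∣²≈x² (x * y) ⟩
        (x * y) * (x * y)                  ≈⟨ solve 2 (λ x y → (x :* y) :* (x :* y) := (x :* x) :* (y :* y)) refl x y ⟩
        (x * x) * (y * y)                  ≈⟨ *-cong (∣x∣²≈x² x) (∣x∣²≈x² y) ⟨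
        (∣ x ∣ * ∣ x ∣) * (∣ y ∣ * ∣ y ∣)  ≈⟨ solve 2 (λ x y → (x :* x) :* (y :* y) := (x :* y) :* (x :* y)) refl ∣ x ∣ ∣ y ∣ ⟩
        (∣ x ∣ * ∣ y ∣) * (∣ x ∣ * ∣ y ∣)  ∎

    ∣x+y∣≤∣x∣+∣y∣ : ∀ x y → ∣ x + y ∣ ≤ ∣ x ∣ + ∣ y ∣
    ∣x+y∣≤∣x∣+∣y∣ x y = ∣x∣≤ (+-mono-≤ (x≤∣x∣ x) (x≤∣x∣ y))
      (≤-respˡ-≈ (solve 2 (λ x y → :- x :+ :- y := :- (x :+ y)) refl x y)
        (+-mono-≤ (-x≤∣x∣ x) (-x≤∣x∣ y)))

    ∣x∣≤y⇒x²≤y² : ∀ {x y} → ∣ x ∣ ≤ y → x * x ≤ y * y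
    ∣x∣≤y⇒x²≤y² {x} ∣x∣≤y = ≤-respˡ-≈ (∣x∣²≈x² x)
      (*-mono-≤ (0≤∣x∣ x) ∣x∣≤y (0≤∣x∣ x) ∣x∣≤y)

    x²≤y²⇒∣x∣≤y : ∀ {x y} → 0# ≤ y → x * x ≤ y * y → ∣ x ∣ ≤ y
    x²≤y²⇒∣x∣≤y {x} 0≤y x²≤y² = x²≤y²⇒x≤y 0≤y (≤-respˡ-≈ (sym (∣x∣²≈x² x)) x²≤y²)

    x²<y²⇒∣x∣<y : ∀ {x y} → 0# ≤ y → x * x < y * y → ∣ x ∣ < y
    x²<y²⇒∣x∣<y {x} 0≤y x²<y² = x²<y²⇒x<y 0≤y (≤-<-trans (≤-reflexive (∣x∣²≈x² x)) x²<y²)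

  open Sum semiring public
    using (sum-cong-≋; ∑-distrib-+; ∑-comm; *-distribˡ-sum; *-distribʳ-sum; sum-replicate-zero)

  opaque
    sum-mono-≤ : ∀ {n} {f g : Vector ℝ n} → (∀ i → f i ≤ g i) → sum f ≤ sum g
    sum-mono-≤ {zero}  f≤g = ≤-refl
    sum-mono-≤ {suc n} f≤g = +-mono-≤ (f≤g zero) (sum-mono-≤ (f≤g ∘ suc))

    sum-zero : ∀ {n} {f : Vector ℝ n} → (∀ i → f i ≈ 0#) → sum f ≈ 0#
    sum-zero {n} f≈0 = trans (sum-cong-≋ f≈0) (sum-replicate-zero n)

    sum-nonneg : ∀ {n} {f : Vector ℝ n} → (∀ i → 0# ≤ f i) → 0# ≤ sum f
    sum-nonneg {n} 0≤f = ≤-respˡ-≈ (sum-replicate-zero n) (sum-mono-≤ 0≤f)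

    term≤sum : ∀ {n} {f : Vector ℝ n} → (∀ i → 0# ≤ f i) → ∀ i → f i ≤ sum f
    term≤sum 0≤f zero    = ≤-by _ (sum-nonneg (0≤f ∘ suc)) refl
    term≤sum 0≤f (suc i) = ≤-trans (term≤sum (0≤f ∘ suc) i) (≤-by _ (0≤f zero) (+-comm _ _))

    ∣sum∣≤ : ∀ {n} (f : Vector ℝ n) → ∣ sum f ∣ ≤ sum (∣_∣ ∘ f)
    ∣sum∣≤ {zero}  f = ≤-reflexive (0≤x⇒∣x∣≈x ≤-refl)
    ∣sum∣≤ {suc n} f = ≤-trans (∣x+y∣≤∣x∣+∣y∣ _ _) (+-mono-≤ ≤-refl (∣sum∣≤ (tail f)))

  -- The base value `0#` gives the empty family a maximum; the families to which this is applied
  -- later consist of norms and constants that are nonnegative.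
  maximum : ∀ {n} → Vector ℝ n → ℝ
  maximum = Vector.foldr _⊔_ 0#

  opaque
    maximum-cong : ∀ {n} {f g : Vector ℝ n} → f ≋ g → maximum f ≈ maximum g
    maximum-cong {zero}  f≋g = refl
    maximum-cong {suc n} f≋g = ⊔-cong (f≋g zero) (maximum-cong (f≋g ∘ suc))

    maximum-nonneg : ∀ {n} (f : Vector ℝ n) → 0# ≤ maximum f
    maximum-nonneg {zero}  f = ≤-refl
    maximum-nonneg {suc n} f = ≤-trans (maximum-nonneg (tail f)) (x≤y⊔x _ _)

    term≤maximum : ∀ {n} (f : Vector ℝ n) i → f i ≤ maximum f
    term≤maximum f zero    = x≤x⊔y _ _
    term≤maximum f (suc i) = ≤-trans (term≤maximum (tail f) i) (x≤y⊔x _ _)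

    maximum-lub : ∀ {n} {f : Vector ℝ n} {b} → 0# ≤ b → (∀ i → f i ≤ b) → maximum f ≤ b
    maximum-lub {zero}  0≤b f≤b = 0≤b
    maximum-lub {suc n} 0≤b f≤b = ⊔-lub (f≤b zero) (maximum-lub 0≤b (f≤b ∘ suc))

  open Exp semiring public using (^-homo-*)

  opaque
    ^-nonneg : ∀ {x} n → 0# ≤ x → 0# ≤ x ^ n
    ^-nonneg zero    0≤x = <⇒≤ 0<1
    ^-nonneg (suc n) 0≤x = *-nonneg 0≤x (^-nonneg n 0≤x)

    ^-pos : ∀ {x} n → 0# < x → 0# < x ^ n
    ^-pos zero    0<x = 0<1
    ^-pos (suc n) 0<x = *-pos 0<x (^-pos n 0<x)

    ^-mono-≤ : ∀ {x y} n → 0# ≤ x → x ≤ y → x ^ n ≤ y ^ n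
    ^-mono-≤ zero    0≤x x≤y = ≤-refl
    ^-mono-≤ (suc n) 0≤x x≤y = *-mono-≤ 0≤x x≤y (^-nonneg n 0≤x) (^-mono-≤ n 0≤x x≤y)

    ^-distrib-* : ∀ x y n → (x * y) ^ n ≈ x ^ n * y ^ n
    ^-distrib-* x y zero    = sym (*-identityˡ 1#)
    ^-distrib-* x y (suc n) = begin-equality
      x * y * (x * y) ^ n        ≈⟨ *-congˡ (^-distrib-* x y n) ⟩
      x * y * (x ^ n * y ^ n)    ≈⟨ solve 4 (λ x y u v → x :* y :* (u :* v) := (x :* u) :* (y :* v)) refl x y (x ^ n) (y ^ n) ⟩
      x * x ^ n * (y * y ^ n)    ∎
      where open ≤R

    x^n≤1 : ∀ {x} n → 0# ≤ x → x ≤ 1# → x ^ n ≤ 1#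
    x^n≤1 zero    0≤x x≤1 = ≤-refl
    x^n≤1 (suc n) 0≤x x≤1 =
      ≤-respʳ-≈ (*-identityˡ 1#) (*-mono-≤ 0≤x x≤1 (^-nonneg n 0≤x) (x^n≤1 n 0≤x x≤1))

    -- A lower bound x of all cⁿ gives the lower bound x (2 - c), because
    -- c (2 - c) ≤ 1; for the largest lower bound s this forces s ≤ 0.
    c^n<ε : ∀ {c ε} → 0# ≤ c → c < 1# → 0# < ε → ∃[ n ] c ^ n < ε
    c^n<ε {c} {ε} 0≤c c<1 0<ε with em {∃[ n ] c ^ n < ε}
    ... | yes p = p
    ... | no ¬p = ⊥-elim (absurd (complete P (ε , ε∈P) (1# , λ x x∈P → x∈P 0)))
      where
      open ≤R
      P : ℝ → Set
      P x = ∀ n → x ≤ c ^ n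
      ε∈P : P ε
      ε∈P n = ≮⇒≥ λ c^n<ε → ¬p (n , c^n<ε)
      0≤2-c : 0# ≤ 1# + 1# - c
      0≤2-c = ≤-respʳ-≈ (solve 1 (λ c → :1 :+ (:1 :- c) := (:1 :+ :1) :- c) refl c)
        (+-nonneg (<⇒≤ 0<1) (0≤y-x (<⇒≤ c<1)))
      [2-c]ct≤t : ∀ {t} → 0# ≤ t → (1# + 1# - c) * (c * t) ≤ t
      [2-c]ct≤t {t} 0≤t = ≤-by ((1# - c) * (1# - c) * t)
        (*-nonneg (0≤x² (1# - c)) 0≤t)
        (solve 2 (λ c t → t := ((:1 :+ :1) :- c) :* (c :* t) :+ (:1 :- c) :* (:1 :- c) :* t) refl c t)
      absurd : ¬ (∃[ s ] IsSup P s)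
      absurd (s , s-ub , s-least) = <⇒≱ (*-pos 0<s (0<y-x c<1)) (≤-by _ (0≤y-x s[2-c]≤s)
        (solve 2 (λ s c → :0 := s :* (:1 :- c) :+ (s :- s :* ((:1 :+ :1) :- c))) refl s c))
        where
        s∈P : P s
        s∈P n = s-least (c ^ n) λ x x∈P → x∈P n
        0<s : 0# < s
        0<s = <-≤-trans 0<ε (s-ub ε ε∈P)
        s[2-c]≤s : s * (1# + 1# - c) ≤ s
        s[2-c]≤s = s-ub (s * (1# + 1# - c)) λ n → begin
          s * (1# + 1# - c)               ≈⟨ *-comm s _ ⟩
          (1# + 1# - c) * s               ≤⟨ *-monoˡ-≤ _ 0≤2-c (s∈P (suc n)) ⟩
          (1# + 1# - c) * (c * c ^ n)     ≤⟨ [2-c]ct≤t (^-nonneg n 0≤c) ⟩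
          c ^ n                           ∎

    0≤fromℕ : ∀ n → 0# ≤ fromℕ n
    0≤fromℕ zero    = ≤-refl
    0≤fromℕ (suc n) = +-nonneg (<⇒≤ 0<1) (0≤fromℕ n)

    0<fromℕ : ∀ n → 0# < fromℕ (suc n)
    0<fromℕ n = +-pos 0<1 (0≤fromℕ n)

    fromℕ-mono-≤ : ∀ {m n} → m ℕ.≤ n → fromℕ m ≤ fromℕ n
    fromℕ-mono-≤ {n = n} ℕ.z≤n = 0≤fromℕ n
    fromℕ-mono-≤ (ℕ.s≤s m≤n) = +-mono-≤ ≤-refl (fromℕ-mono-≤ m≤n)

    sum-const≤ : ∀ {n} {f : Vector ℝ n} {b} → (∀ i → f i ≤ b) → sum f ≤ fromℕ n * b
    sum-const≤ {zero}  {b = b} f≤b = ≤-reflexive (sym (zeroˡ b))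
    sum-const≤ {suc n} {b = b} f≤b = ≤-respʳ-≈
      (solve 2 (λ b m → b :+ m :* b := (:1 :+ m) :* b) refl b (fromℕ n))
      (+-mono-≤ (f≤b zero) (sum-const≤ (f≤b ∘ suc)))

-- Matrix action, the ℓ¹ norm and its comparison with the Euclidean norm.

module Norms (em : ExcludedMiddle 0ℓ) (R : CompleteOrderedField) where
  open CompleteOrderedField R hiding (zero)
  open Analysis R
  open LinearAlgebra rawRing
  open OrderedFieldProperties em R

  𝟎 : ∀ {n} → Vector ℝ n
  𝟎 = Vector.replicate _ 0#

  opaque
    ∗-cong : ∀ {n} (M : Matrix ℝ n) {x y} → x ≋ y → M ∗ x ≋ M ∗ y
    ∗-cong M x≋y i = sum-cong-≋ λ j → *-congˡ (x≋y j)

    ∗-distrib-⊕ : ∀ {n} (M : Matrix ℝ n) x y → M ∗ (x ⊕ y) ≋ (M ∗ x) ⊕ (M ∗ y)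
    ∗-distrib-⊕ M x y i = trans (sum-cong-≋ λ j → distribˡ (M i j) (x j) (y j))
      (∑-distrib-+ (λ j → M i j * x j) (λ j → M i j * y j))

    ∗-∙ : ∀ {n} (M : Matrix ℝ n) t x → M ∗ (t ∙ x) ≋ t ∙ (M ∗ x)
    ∗-∙ M t x i = trans
      (sum-cong-≋ λ j → solve 3 (λ m t x → m :* (t :* x) := t :* (m :* x)) refl (M i j) t (x j))
      (sym (*-distribˡ-sum t (λ j → M i j * x j)))

    ∗-distrib-⊖ : ∀ {n} (M : Matrix ℝ n) x y → M ∗ (x ⊖ y) ≋ (M ∗ x) ⊖ (M ∗ y)
    ∗-distrib-⊖ M x y i = begin-equality
      (M ∗ (x ⊖ y)) i                     ≈⟨ ∗-cong M (λ j → solve 2 (λ x y → x :- y := x :+ (:- :1) :* y) refl (x j) (y j)) i ⟩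
      (M ∗ (x ⊕ (- 1# ∙ y))) i            ≈⟨ ∗-distrib-⊕ M x (- 1# ∙ y) i ⟩
      (M ∗ x) i + (M ∗ (- 1# ∙ y)) i      ≈⟨ +-congˡ (∗-∙ M (- 1#) y i) ⟩
      (M ∗ x) i + - 1# * (M ∗ y) i        ≈⟨ solve 2 (λ x y → x :+ (:- :1) :* y := x :- y) refl _ _ ⟩
      (M ∗ x) i - (M ∗ y) i               ∎
      where open ≤R

    ∗-zeroʳ : ∀ {n} (M : Matrix ℝ n) {x} → x ≋ 𝟎 → M ∗ x ≋ 𝟎
    ∗-zeroʳ M x≋0 i = sum-zero λ j → trans (*-congˡ (x≋0 j)) (zeroʳ _)

    ·-∗ : ∀ {n} (M N : Matrix ℝ n) x → (M · N) ∗ x ≋ M ∗ (N ∗ x)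
    ·-∗ M N x i = begin-equality
      sum (λ j → sum (λ l → M i l * N l j) * x j)     ≈⟨ sum-cong-≋ (λ j → *-distribʳ-sum (x j) (λ l → M i l * N l j)) ⟩
      sum (λ j → sum (λ l → M i l * N l j * x j))     ≈⟨ ∑-comm (λ j l → M i l * N l j * x j) ⟩
      sum (λ l → sum (λ j → M i l * N l j * x j))     ≈⟨ sum-cong-≋ (λ l → sum-cong-≋ λ j → *-assoc (M i l) (N l j) (x j)) ⟩
      sum (λ l → sum (λ j → M i l * (N l j * x j)))   ≈⟨ sum-cong-≋ (λ l → *-distribˡ-sum (M i l) (λ j → N l j * x j)) ⟨
      sum (λ l → M i l * sum (λ j → N l j * x j))     ∎
      where open ≤R

    identity-∗ : ∀ {n} (x : Vector ℝ n) → identity ∗ x ≋ x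
    identity-∗ x zero    = trans (+-cong (*-identityˡ _) (sum-zero λ j → zeroˡ (tail x j))) (+-identityʳ _)
    identity-∗ x (suc i) = trans (+-cong (zeroˡ _) (identity-∗ (tail x) i)) (+-identityˡ _)

    -- The ℓ¹ norm is given by a formula without square roots and its norm axioms hold term by term,
    -- whereas the Euclidean norm is available only as the relation `IsEuclideanNorm`.
    ∥_∥ : ∀ {n} → Vector ℝ n → ℝ
    ∥ x ∥ = sum (∣_∣ ∘ x)

    ∣xᵢ∣≤∥x∥ : ∀ {n} (x : Vector ℝ n) i → ∣ x i ∣ ≤ ∥ x ∥
    ∣xᵢ∣≤∥x∥ x = term≤sum (0≤∣x∣ ∘ x)

    ∥∥-isNorm : ∀ {n} → IsNorm (∥_∥ {n})
    ∥∥-isNorm = record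
      { cong        = λ x≋y → sum-cong-≋ (∣∣-cong ∘ x≋y)
      ; nonneg      = λ x → sum-nonneg (0≤∣x∣ ∘ x)
      ; definite    = λ x ∥x∥≈0 i → ∣x∣≈0⇒x≈0
          (antisym (≤-respʳ-≈ ∥x∥≈0 (∣xᵢ∣≤∥x∥ x i)) (0≤∣x∣ (x i)))
      ; homogeneous = λ t x → trans (sum-cong-≋ (∣xy∣≈∣x∣∣y∣ t ∘ x))
          (sym (*-distribˡ-sum ∣ t ∣ (∣_∣ ∘ x)))
      ; triangle    = λ x y → ≤-respʳ-≈ (∑-distrib-+ (∣_∣ ∘ x) (∣_∣ ∘ y))
          (sum-mono-≤ λ i → ∣x+y∣≤∣x∣+∣y∣ (x i) (y i))
      }

  module ∥∥ {n} = IsNorm (∥∥-isNorm {n})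

  opaque
    unfolding ∥_∥

    ∥∥-zero : ∀ {n} {x : Vector ℝ n} → x ≋ 𝟎 → ∥ x ∥ ≈ 0#
    ∥∥-zero x≋0 = sum-zero λ i → trans (∣∣-cong (x≋0 i)) (0≤x⇒∣x∣≈x ≤-refl)

    ∥∥-uncons : ∀ {n} (x : Vector ℝ (suc n)) → ∥ x ∥ ≈ ∣ head x ∣ + ∥ tail x ∥
    ∥∥-uncons x = refl

    -- The constant is the sum of the absolute values of all entries: row i contributes at most
    -- `∥ M i ∥ * ∥ x ∥`.
    ∗-bounded : ∀ {n} (M : Matrix ℝ n) → ∃[ C ] 0# ≤ C × (∀ x → ∥ M ∗ x ∥ ≤ C * ∥ x ∥)
    ∗-bounded M = sum (∥_∥ ∘ M) , sum-nonneg (∥∥.nonneg ∘ M) , λ x → begin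
      sum (λ i → ∣ (M ∗ x) i ∣)    ≤⟨ sum-mono-≤ (row x) ⟩
      sum (λ i → ∥ M i ∥ * ∥ x ∥)  ≈⟨ *-distribʳ-sum ∥ x ∥ (∥_∥ ∘ M) ⟨
      sum (∥_∥ ∘ M) * ∥ x ∥        ∎
      where
      open ≤R
      row : ∀ x i → ∣ (M ∗ x) i ∣ ≤ ∥ M i ∥ * ∥ x ∥
      row x i = begin
        ∣ sum (λ j → M i j * x j) ∣      ≤⟨ ∣sum∣≤ (λ j → M i j * x j) ⟩
        sum (λ j → ∣ M i j * x j ∣)      ≈⟨ sum-cong-≋ (λ j → ∣xy∣≈∣x∣∣y∣ (M i j) (x j)) ⟩
        sum (λ j → ∣ M i j ∣ * ∣ x j ∣)  ≤⟨ sum-mono-≤ (λ j → *-monoˡ-≤ _ (0≤∣x∣ (M i j)) (∣xᵢ∣≤∥x∥ x j)) ⟩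
        sum (λ j → ∣ M i j ∣ * ∥ x ∥)    ≈⟨ *-distribʳ-sum ∥ x ∥ (∣_∣ ∘ M i) ⟨
        ∥ M i ∥ * ∥ x ∥                  ∎

    normSquared-nonneg : ∀ {n} (x : Vector ℝ n) → 0# ≤ normSquared x
    normSquared-nonneg x = sum-nonneg λ i → 0≤x² (x i)

    xᵢ²≤normSquared : ∀ {n} (x : Vector ℝ n) i → x i * x i ≤ normSquared x
    xᵢ²≤normSquared x = term≤sum λ i → 0≤x² (x i)

    normSquared≤∥∥² : ∀ {n} (x : Vector ℝ n) → normSquared x ≤ ∥ x ∥ * ∥ x ∥
    normSquared≤∥∥² {zero}  x = ≤-reflexive (sym (zeroˡ 0#))
    normSquared≤∥∥² {suc n} x = begin
      a * a + normSquared (tail x)   ≤⟨ +-mono-≤ (≤-reflexive (sym (∣x∣²≈x² a))) (normSquared≤∥∥² (tail x)) ⟩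
      ∣ a ∣ * ∣ a ∣ + r * r          ≤⟨ ≤-by _ (+-nonneg 0≤ar 0≤ar)
                                         (solve 2 (λ a r → (a :+ r) :* (a :+ r) := (a :* a :+ r :* r) :+ (a :* r :+ a :* r)) refl ∣ a ∣ r) ⟩
      (∣ a ∣ + r) * (∣ a ∣ + r)      ∎
      where
      open ≤R
      a r : ℝ
      a = head x
      r = ∥ tail x ∥
      0≤ar : 0# ≤ ∣ a ∣ * r
      0≤ar = *-nonneg (0≤∣x∣ a) (∥∥.nonneg (tail x))

    root-square : ∀ {x t} → IsRoot 2 x t → t * t ≈ x
    root-square {t = t} (_ , t²≈x) = trans (*-congˡ (sym (*-identityʳ t))) t²≈x

    euclidean≤∥∥ : ∀ {n} {x : Vector ℝ n} {t} → IsEuclideanNorm x t → t ≤ ∥ x ∥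
    euclidean≤∥∥ {x = x} norm = x²≤y²⇒x≤y (∥∥.nonneg x)
      (≤-respˡ-≈ (sym (root-square norm)) (normSquared≤∥∥² x))

    ∥∥≤n*euclidean : ∀ {n} {x : Vector ℝ n} {t} → IsEuclideanNorm x t → ∥ x ∥ ≤ fromℕ n * t
    ∥∥≤n*euclidean {x = x} norm = sum-const≤ λ i → x²≤y²⇒∣x∣≤y (proj₁ norm)
      (≤-respʳ-≈ (sym (root-square norm)) (xᵢ²≤normSquared x i))

    ball⇒∣∣< : ∀ {n} (x y : Vector ℝ n) {ε} → 0# < ε → Ball x ε y → ∀ i → ∣ y i - x i ∣ < ε
    ball⇒∣∣< x y 0<ε y∈B i =
      x²<y²⇒∣x∣<y (<⇒≤ 0<ε) (≤-<-trans (xᵢ²≤normSquared (y ⊖ x) i) y∈B)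

    ball⇒∥∥≤ : ∀ {n} (x y : Vector ℝ n) {ε} → 0# < ε → Ball x ε y → ∥ y ⊖ x ∥ ≤ fromℕ n * ε
    ball⇒∥∥≤ x y 0<ε y∈B = sum-const≤ (<⇒≤ ∘ ball⇒∣∣< x y 0<ε y∈B)

    -- Take δ as the smaller of b and ε / (1 + C). The divisor is 1 + C because C may vanish, and
    -- the added 1 makes the inequality strict: ε exceeds C ε / (1 + C) by ε / (1 + C).
    small-multiple : ∀ {C ε b} → 0# ≤ C → 0# < ε → 0# < b → ∃[ δ ] 0# < δ × δ ≤ b × C * δ < ε
    small-multiple {C} {ε} 0≤C 0<ε 0<b =
      let (δ , 0<δ , δ≤b , δ≤ε/1+C) = min₂ 0<b 0<ε/1+C in
      δ , 0<δ , δ≤b , ≤-<-trans (*-monoˡ-≤ C 0≤C δ≤ε/1+C) (<-by _ 0<ε/1+C (begin-equality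
        ε                           ≈⟨ *-identityʳ ε ⟨
        ε * 1#                      ≈⟨ *-congˡ (x*x⁻¹≈1 0<1+C) ⟨
        ε * ((1# + C) * i)          ≈⟨ solve 3 (λ e c i → e :* ((:1 :+ c) :* i) := c :* (e :* i) :+ e :* i) refl ε C i ⟩
        C * (ε * i) + ε * i         ∎))
      where
      open ≤R
      0<1+C : 0# < 1# + C
      0<1+C = +-pos 0<1 0≤C
      i : ℝ
      i = (1# + C) ⁻¹
      0<ε/1+C : 0# < ε * i
      0<ε/1+C = *-pos 0<ε (⁻¹-pos 0<1+C)

    -- This serves as the continuity of powers in the construction of roots. Splitting off one
    -- factor x + d from the power yields the recursion C′ = b C + bⁿ for the constant.
    ^-lipschitz : ∀ n b → 0# ≤ b → ∃[ C ] 0# ≤ C ×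
      (∀ x d → 0# ≤ x → 0# ≤ d → x + d ≤ b → (x + d) ^ n ≤ x ^ n + C * d)
    ^-lipschitz zero b 0≤b = 0# , ≤-refl , λ x d _ _ _ → ≤-by 0# ≤-refl
      (solve 1 (λ d → :1 :+ :0 :* d := :1 :+ :0) refl d)
    ^-lipschitz (suc n) b 0≤b = let (C , 0≤C , lip) = ^-lipschitz n b 0≤b in
      b * C + b ^ n , +-nonneg (*-nonneg 0≤b 0≤C) (^-nonneg n 0≤b) , λ x d 0≤x 0≤d x+d≤b →
      let 0≤x+d = +-nonneg 0≤x 0≤d
          x≤b = ≤-trans (≤-by d 0≤d refl) x+d≤b in begin
        (x + d) * (x + d) ^ n                             ≤⟨ *-monoˡ-≤ (x + d) 0≤x+d (lip x d 0≤x 0≤d x+d≤b) ⟩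
        (x + d) * (x ^ n + C * d)                         ≈⟨ solve 4 (λ x d p c → (x :+ d) :* (p :+ c :* d) := (x :* p :+ c :* d :* (x :+ d)) :+ d :* p) refl x d (x ^ n) C ⟩
        (x * x ^ n + C * d * (x + d)) + d * x ^ n         ≤⟨ +-mono-≤ (+-mono-≤ ≤-refl (*-monoˡ-≤ (C * d) (*-nonneg 0≤C 0≤d) x+d≤b))
                                                                      (*-monoˡ-≤ d 0≤d (^-mono-≤ n 0≤x x≤b)) ⟩
        (x * x ^ n + C * d * b) + d * b ^ n               ≈⟨ solve 5 (λ q c d b p → (q :+ c :* d :* b) :+ d :* p := q :+ (b :* c :+ p) :* d) refl (x * x ^ n) C d b (b ^ n) ⟩
        x * x ^ n + (b * C + b ^ n) * d                   ∎
      where open ≤R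

    1≤x^n : ∀ {x} n → 1# ≤ x → 1# ≤ x ^ n
    1≤x^n zero    1≤x = ≤-refl
    1≤x^n (suc n) 1≤x = ≤-respˡ-≈ (*-identityˡ 1#)
      (*-mono-≤ (<⇒≤ 0<1) 1≤x (<⇒≤ 0<1) (1≤x^n n 1≤x))

-- Existence of roots and of operator norms.

module OperatorNorms (em : ExcludedMiddle 0ℓ) (R : CompleteOrderedField) where
  open CompleteOrderedField R hiding (zero)
  open Analysis R
  open LinearAlgebra rawRing
  open OrderedFieldProperties em R
  open Norms em R

  opaque
    ^-increase : ∀ n {s y} → 0# ≤ s → s ^ n < y → ∃[ δ ] 0# < δ × (s + δ) ^ n ≤ y
    ^-increase n {s} {y} 0≤s s^n<y
      with ^-lipschitz n (s + 1#) (+-nonneg 0≤s (<⇒≤ 0<1))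
    ... | C , 0≤C , lip
      with small-multiple 0≤C (0<y-x s^n<y) 0<1
    ... | δ , 0<δ , δ≤1 , Cδ<gap = δ , 0<δ , (begin
      (s + δ) ^ n              ≤⟨ lip s δ 0≤s (<⇒≤ 0<δ) (+-mono-≤ ≤-refl δ≤1) ⟩
      s ^ n + C * δ            ≤⟨ +-mono-≤ ≤-refl (<⇒≤ Cδ<gap) ⟩
      s ^ n + (y - s ^ n)      ≈⟨ solve 2 (λ p y → p :+ (y :- p) := y) refl (s ^ n) y ⟩
      y                        ∎)
      where open ≤R

  opaque
    -- The Lipschitz estimate speaks of nonnegative increments only, so it is applied at the base
    -- point s - δ with increment δ; the condition δ ≤ s keeps that base point nonnegative.
    ^-decrease : ∀ n {s y} → 0# < s → y < s ^ n →
      ∃[ δ ] 0# < δ × 0# ≤ s - δ × y < (s - δ) ^ n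
    ^-decrease n {s} {y} 0<s y<s^n
      with ^-lipschitz n s (<⇒≤ 0<s)
    ... | C , 0≤C , lip
      with small-multiple 0≤C (0<y-x y<s^n) 0<s
    ... | δ , 0<δ , δ≤s , Cδ<gap = δ , 0<δ , 0≤y-x δ≤s ,
      <-by _ (+-pos (0<y-x Cδ<gap) (0≤y-x s^n≤))
        (solve 4 (λ y p q c → q := y :+ ((p :- y :- c) :+ ((q :+ c) :- p))) refl y (s ^ n) ((s - δ) ^ n) (C * δ))
      where
      open ≤R
      s≈s-δ+δ : s ≈ s - δ + δ
      s≈s-δ+δ = solve 2 (λ s d → s := s :- d :+ d) refl s δ
      s^n≤ : s ^ n ≤ (s - δ) ^ n + C * δ
      s^n≤ = begin
        s ^ n                ≤⟨ ^-mono-≤ n (<⇒≤ 0<s) (≤-reflexive s≈s-δ+δ) ⟩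
        (s - δ + δ) ^ n      ≤⟨ lip (s - δ) δ (0≤y-x δ≤s) (<⇒≤ 0<δ) (≤-reflexive (sym s≈s-δ+δ)) ⟩
        (s - δ) ^ n + C * δ  ∎

  -- The root of order n + 1 will be the supremum of this set. The weak inequality keeps 0 in the
  -- set even for y = 0.
  IsSubroot : ℕ → ℝ → ℝ → Set
  IsSubroot n y t = 0# ≤ t × t ^ suc n ≤ y

  opaque
    0-isSubroot : ∀ n {y} → 0# ≤ y → IsSubroot n y 0#
    0-isSubroot n 0≤y = ≤-refl , ≤-respˡ-≈ (sym (zeroˡ _)) 0≤y

    -- If t exceeds 1, then t is at most its own power and hence at most y; adding 1 covers the
    -- remaining t.
    subroot≤1+y : ∀ n {y} → 0# ≤ y → IsUpperBound (IsSubroot n y) (1# + y)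
    subroot≤1+y n {y} 0≤y t (0≤t , t^m≤y) with total t 1#
    ... | inj₁ t≤1 = ≤-trans t≤1 (≤-by y 0≤y refl)
    ... | inj₂ 1≤t = begin
      t            ≈⟨ *-identityʳ t ⟨
      t * 1#       ≤⟨ *-monoˡ-≤ t 0≤t (1≤x^n n 1≤t) ⟩
      t * t ^ n    ≤⟨ t^m≤y ⟩
      y            ≤⟨ ≤-by 1# (<⇒≤ 0<1) (+-comm 1# y) ⟩
      1# + y       ∎
      where open ≤R

  opaque
    -- If the power of s were below y, a slightly larger number would still be a subroot; if it were
    -- above y, a slightly smaller number would already bound all subroots. Both contradict the
    -- choice of s.
    sup-subroots : ∀ n {y s} → 0# ≤ y → IsSup (IsSubroot n y) s → IsRoot (suc n) y s
    sup-subroots n {y} {s} 0≤y (s-ub , s-least) = 0≤s , antisym (≮⇒≥ y≮s^m) (≮⇒≥ s^m≮y)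
      where
      0≤s : 0# ≤ s
      0≤s = s-ub 0# (0-isSubroot n 0≤y)
      s^m≮y : ¬ s ^ suc n < y
      s^m≮y s^m<y with ^-increase (suc n) 0≤s s^m<y
      ... | δ , 0<δ , [s+δ]^m≤y =
        <⇒≱ (<-+ 0<δ) (s-ub (s + δ) (+-nonneg 0≤s (<⇒≤ 0<δ) , [s+δ]^m≤y))
      0<s : y < s ^ suc n → 0# < s
      0<s y<s^m = 0≤s , λ 0≈s → <⇒≱ y<s^m (≤-respˡ-≈ (trans (sym (zeroˡ _)) (*-congʳ 0≈s)) 0≤y)
      y≮s^m : ¬ y < s ^ suc n
      y≮s^m y<s^m with ^-decrease (suc n) (0<s y<s^m) y<s^m
      ... | δ , 0<δ , 0≤s-δ , y<[s-δ]^m =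
        <⇒≱ (<-by δ 0<δ (solve 2 (λ s d → s := s :- d :+ d) refl s δ))
          (s-least (s - δ) λ t (0≤t , t^m≤y) → ≮⇒≥ λ s-δ<t →
            <⇒≱ y<[s-δ]^m (≤-trans (^-mono-≤ (suc n) 0≤s-δ (<⇒≤ s-δ<t)) t^m≤y))

  opaque
    root-exists : ∀ n {y} → 0# ≤ y → ∃[ t ] IsRoot (suc n) y t
    root-exists n {y} 0≤y =
      let (s , s-sup) = complete (IsSubroot n y) (0# , 0-isSubroot n 0≤y)
                          (1# + y , subroot≤1+y n 0≤y) in
      s , sup-subroots n 0≤y s-sup

  opaque
    euclideanNorm-exists : ∀ {n} (x : Vector ℝ n) → ∃[ t ] IsEuclideanNorm x t
    euclideanNorm-exists x = root-exists 1 (normSquared-nonneg x)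

    euclidean-𝟎≤1 : ∀ {n t} → IsEuclideanNorm (𝟎 {n}) t → t ≤ 1#
    euclidean-𝟎≤1 {n} {t} t-norm = begin
      t            ≤⟨ euclidean≤∥∥ {x = 𝟎 {n}} t-norm ⟩
      ∥ 𝟎 {n} ∥    ≈⟨ ∥∥-zero (λ _ → refl) ⟩
      0#           ≤⟨ <⇒≤ 0<1 ⟩
      1#           ∎
      where open ≤R

  opaque
    -- Completeness applies because the zero vector makes the set of values nonempty, and an ℓ¹
    -- bound for M bounds it after conversion on both sides; the factor `fromℕ n` comes from
    -- bounding ℓ¹ by Euclidean length on the unit ball.
    operatorNorm-exists : ∀ {n} (M : Matrix ℝ n) → ∃[ c ] IsOperatorNorm M c
    operatorNorm-exists {n} M with ∗-bounded M | euclideanNorm-exists (𝟎 {n}) | euclideanNorm-exists (M ∗ 𝟎)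
    ... | C , 0≤C , M-bound | s , s-norm | t , t-norm = complete _
      (t , 𝟎 , (s , s-norm , euclidean-𝟎≤1 {n} s-norm) , t-norm)
      (C * fromℕ n , λ t (x , (s , s-norm , s≤1) , t-norm) → begin
        t                    ≤⟨ euclidean≤∥∥ {x = M ∗ x} t-norm ⟩
        ∥ M ∗ x ∥            ≤⟨ M-bound x ⟩
        C * ∥ x ∥            ≤⟨ *-monoˡ-≤ C 0≤C (∥∥≤n*euclidean {x = x} s-norm) ⟩
        C * (fromℕ n * s)    ≤⟨ *-monoˡ-≤ C 0≤C (*-monoˡ-≤ (fromℕ n) (0≤fromℕ n) s≤1) ⟩
        C * (fromℕ n * 1#)   ≈⟨ *-congˡ (*-identityʳ _) ⟩
        C * fromℕ n          ∎)
      where open ≤R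

  opaque
    operatorNorm-nonneg : ∀ {n} {M : Matrix ℝ n} {c} → IsOperatorNorm M c → 0# ≤ c
    operatorNorm-nonneg {n} {M} (c-ub , _) =
      let (s , s-norm) = euclideanNorm-exists (𝟎 {n})
          (t , t-norm) = euclideanNorm-exists (M ∗ 𝟎) in
      ≤-trans (proj₁ t-norm) (c-ub t (𝟎 , (s , s-norm , euclidean-𝟎≤1 {n} s-norm) , t-norm))

  opaque
    -- Dividing x by its ℓ¹ norm places it in the Euclidean unit ball, because the Euclidean norm is
    -- the smaller one. Only the return to ℓ¹ on the image side costs the factor `fromℕ n`. The
    -- vector 0 cannot be normalised and is treated apart.
    operatorNorm-bound : ∀ {n} {M : Matrix ℝ n} {c} → IsOperatorNorm M c →
      ∀ x → ∥ M ∗ x ∥ ≤ fromℕ n * c * ∥ x ∥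
    operatorNorm-bound {n} {M} {c} c-norm x with 0≤⇒0≈⊎0< (∥∥.nonneg x)
    ... | inj₁ 0≈∥x∥ = ≤-reflexive (begin-equality
      ∥ M ∗ x ∥               ≈⟨ ∥∥-zero (∗-zeroʳ M (∥∥.definite x (sym 0≈∥x∥))) ⟩
      0#                      ≈⟨ zeroʳ _ ⟨
      fromℕ n * c * 0#        ≈⟨ *-congˡ 0≈∥x∥ ⟩
      fromℕ n * c * ∥ x ∥     ∎)
      where open ≤R
    ... | inj₂ 0<∥x∥ = *-cancelˡ-≤ r (⁻¹-pos 0<∥x∥) (begin
      r * ∥ M ∗ x ∥                ≈⟨ scale (M ∗ x) ⟨
      ∥ r ∙ (M ∗ x) ∥              ≈⟨ ∥∥.cong (∗-∙ M r x) ⟨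
      ∥ M ∗ (r ∙ x) ∥              ≤⟨ ∥∥≤n*euclidean {x = M ∗ (r ∙ x)} (proj₂ t-norm) ⟩
      fromℕ n * proj₁ t-norm       ≤⟨ *-monoˡ-≤ (fromℕ n) (0≤fromℕ n) (proj₁ c-norm _ (r ∙ x , (proj₁ s-norm , proj₂ s-norm , s≤1) , proj₂ t-norm)) ⟩
      fromℕ n * c                  ≈⟨ *-identityʳ _ ⟨
      fromℕ n * c * 1#             ≈⟨ *-congˡ (x*x⁻¹≈1 0<∥x∥) ⟨
      fromℕ n * c * (∥ x ∥ * r)    ≈⟨ solve 3 (λ c x r → c :* (x :* r) := r :* (c :* x)) refl (fromℕ n * c) ∥ x ∥ r ⟩
      r * (fromℕ n * c * ∥ x ∥)    ∎)
      where
      open ≤R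
      r : ℝ
      r = ∥ x ∥ ⁻¹
      scale : ∀ (y : Vector ℝ n) → ∥ r ∙ y ∥ ≈ r * ∥ y ∥
      scale y = trans (∥∥.homogeneous r y) (*-congʳ (0≤x⇒∣x∣≈x (<⇒≤ (⁻¹-pos 0<∥x∥))))
      s-norm : ∃[ s ] IsEuclideanNorm (r ∙ x) s
      s-norm = euclideanNorm-exists (r ∙ x)
      t-norm : ∃[ t ] IsEuclideanNorm (M ∗ (r ∙ x)) t
      t-norm = euclideanNorm-exists (M ∗ (r ∙ x))
      s≤1 : proj₁ s-norm ≤ 1#
      s≤1 = ≤-respʳ-≈ (trans (scale x) (trans (*-comm _ _) (x*x⁻¹≈1 0<∥x∥))) (euclidean≤∥∥ {x = r ∙ x} (proj₂ s-norm))

-- From the joint spectral radius to a norm contracted by every scaled digit matrix.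

module AdaptedNorm (em : ExcludedMiddle 0ℓ) (R : CompleteOrderedField) where
  open CompleteOrderedField R hiding (zero)
  open Analysis R
  open LinearAlgebra rawRing
  open OrderedFieldProperties em R
  open Norms em R
  open OperatorNorms em R

  ProductsBoundedBy : ∀ {k n} → Vector (Matrix ℝ n) k → ℕ → ℝ → Set
  ProductsBoundedBy {k} B l C =
    ∀ (w : Vector (Fin k) l) x → ∥ wordProduct B w ∗ x ∥ ≤ C * ∥ x ∥

  opaque
    -- The limit superior is the infimum of the tail suprema, so some tail supremum lies below ρ;
    -- otherwise ρ would be a lower bound of them all and hence at most ρ*. The entry `u l` belongs
    -- to words of length l + 1, whence the shift in the lengths.
    jsr-eventually : ∀ {k n} (B : Vector (Matrix ℝ n) k) {ρ* ρ} →
      IsJointSpectralRadius B ρ* → ρ* < ρ →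
      ∃[ s ] 0# ≤ s × s < ρ × ∃[ N ] (∀ l → N ℕ.≤ l →
        ProductsBoundedBy B (suc l) (fromℕ n * s ^ suc l))
    jsr-eventually {n = n} B {ρ*} {ρ} (u , u-max , s , s-sup , _ , ρ*-greatest) ρ*<ρ
      with em {∃[ N ] s N < ρ}
    ... | no ¬p = ⊥-elim (<⇒≱ ρ*<ρ (ρ*-greatest ρ λ t (N , t≈sN) →
            ≤-respʳ-≈ (sym t≈sN) (≮⇒≥ λ sN<ρ → ¬p (N , sN<ρ))))
    ... | yes (N , sN<ρ) = s N , 0≤sN , sN<ρ , N , λ l N≤l w x →
        let (c , c-norm)           = operatorNorm-exists (wordProduct B w)
            (t , t-root@(0≤t , t^l≈c)) = root-exists l (operatorNorm-nonneg c-norm)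
            t≤sN                   = ≤-trans (proj₂ (u-max l) t (w , c , c-norm , t-root))
                                             (proj₁ (s-sup N) (u l) (l , N≤l , refl))
            c≤sN^l                 = ≤-respˡ-≈ t^l≈c (^-mono-≤ (suc l) 0≤t t≤sN) in
        ≤-trans (operatorNorm-bound c-norm x)
          (*-monoʳ-≤ (∥∥.nonneg x) (*-monoˡ-≤ (fromℕ n) (0≤fromℕ n) c≤sN^l))
      where
      -- The maximum `u N` is attained by a root, and roots are nonnegative by definition.
      0≤sN : 0# ≤ s N
      0≤sN = let ((_ , _ , _ , 0≤uN , _) , _) = u-max N in
        ≤-trans 0≤uN (proj₁ (s-sup N) (u N) (N , ℕ.≤-refl , refl))

  opaque
    -- Enlarging s to some q < ρ absorbs the dimension factor: n (s / q)ˡ ≤ 1 as soon as the length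
    -- l is large. A single such length is enough for the norm built below.
    jsr-uniform : ∀ {k n} (B : Vector (Matrix ℝ n) k) {ρ* ρ} →
      IsJointSpectralRadius B ρ* → ρ* < ρ →
      ∃[ q ] 0# < q × q < ρ × ∃[ l ] ProductsBoundedBy B (suc l) (q ^ suc l)
    jsr-uniform {n = n} B jsr ρ*<ρ with jsr-eventually B jsr ρ*<ρ
    ... | s , 0≤s , s<ρ , N , bounded with between s<ρ
    ... | q , s<q , q<ρ = q , 0<q , q<ρ , N ℕ.+ proj₁ p , λ w x →
        ≤-trans (bounded (N ℕ.+ proj₁ p) (ℕ.m≤m+n N _) w x) (*-monoʳ-≤ (∥∥.nonneg x) n*s^l≤q^l)
      where
      open ≤R
      0<q : 0# < q
      0<q = ≤-<-trans 0≤s s<q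
      r : ℝ
      r = s * q ⁻¹
      0≤r : 0# ≤ r
      0≤r = *-nonneg 0≤s (<⇒≤ (⁻¹-pos 0<q))
      s≈rq : s ≈ r * q
      s≈rq = begin-equality
        s                  ≈⟨ *-identityʳ s ⟨
        s * 1#             ≈⟨ *-congˡ (x*x⁻¹≈1 0<q) ⟨
        s * (q * q ⁻¹)     ≈⟨ solve 3 (λ s q i → s :* (q :* i) := s :* i :* q) refl s q (q ⁻¹) ⟩
        r * q              ∎
      r<1 : r < 1#
      r<1 = x/y<1 0<q s<q
      -- The dimension n may be 0, so n + 1 is inverted instead.
      0<m⁻¹ : 0# < fromℕ (suc n) ⁻¹
      0<m⁻¹ = ⁻¹-pos (0<fromℕ n)
      p : ∃[ p ] r ^ p < fromℕ (suc n) ⁻¹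
      p = c^n<ε 0≤r r<1 0<m⁻¹
      l : ℕ
      l = N ℕ.+ proj₁ p
      n*r^l≤1 : fromℕ n * r ^ suc l ≤ 1#
      n*r^l≤1 = begin
        fromℕ n * r ^ suc l                     ≤⟨ *-mono-≤ (0≤fromℕ n) (fromℕ-mono-≤ (ℕ.n≤1+n n)) (^-nonneg (suc l) 0≤r) (begin
            r ^ suc l                      ≈⟨ ^-homo-* r (suc N) (proj₁ p) ⟩
            r ^ suc N * r ^ proj₁ p        ≤⟨ *-monoʳ-≤ (^-nonneg (proj₁ p) 0≤r) (x^n≤1 (suc N) 0≤r (<⇒≤ r<1)) ⟩
            1# * r ^ proj₁ p               ≈⟨ *-identityˡ _ ⟩
            r ^ proj₁ p                    ≤⟨ <⇒≤ (proj₂ p) ⟩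
            fromℕ (suc n) ⁻¹               ∎) ⟩
        fromℕ (suc n) * fromℕ (suc n) ⁻¹        ≈⟨ x*x⁻¹≈1 (0<fromℕ n) ⟩
        1#                                      ∎
      n*s^l≤q^l : fromℕ n * s ^ suc l ≤ q ^ suc l
      n*s^l≤q^l = begin
        fromℕ n * s ^ suc l                      ≤⟨ *-monoˡ-≤ (fromℕ n) (0≤fromℕ n) (^-mono-≤ (suc l) 0≤s (≤-reflexive s≈rq)) ⟩
        fromℕ n * (r * q) ^ suc l                ≈⟨ *-congˡ (^-distrib-* r q (suc l)) ⟩
        fromℕ n * (r ^ suc l * q ^ suc l)        ≈⟨ *-assoc _ _ _ ⟨
        fromℕ n * r ^ suc l * q ^ suc l          ≤⟨ *-monoʳ-≤ (^-nonneg (suc l) (<⇒≤ 0<q)) n*r^l≤1 ⟩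
        1# * q ^ suc l                           ≈⟨ *-identityˡ _ ⟩
        q ^ suc l                                ∎

  -- The constant C makes N continuous for the topology of Euclidean balls in which `IsOpen` and
  -- `IsCompact` are stated.
  record BoundedNorm {n} (N : Vector ℝ n → ℝ) : Set where
    field
      isNorm  : IsNorm N
      C       : ℝ
      0≤C     : 0# ≤ C
      N≤C*∥∥  : ∀ x → N x ≤ C * ∥ x ∥
    open IsNorm isNorm public

  private
    *-distrib-⊔ : ∀ {t} → 0# ≤ t → ∀ x y → t * (x ⊔ y) ≈ (t * x) ⊔ (t * y)
    *-distrib-⊔ {t} 0≤t = Max.mono-≤-distrib-⊔ totalOrder *-congˡ (*-monoˡ-≤ t 0≤t)

  opaque
    maximum-* : ∀ {m t} → 0# ≤ t → (f : Vector ℝ m) → maximum (λ i → t * f i) ≈ t * maximum f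
    maximum-* {zero}  {t} 0≤t f = sym (zeroʳ t)
    maximum-* {suc m} {t} 0≤t f = trans (⊔-cong refl (maximum-* 0≤t (tail f)))
      (sym (*-distrib-⊔ 0≤t (head f) (maximum (tail f))))

  -- The term `∥ x ∥` keeps the result definite even when all the matrices are singular.
  join : ∀ {k n} → Vector (Matrix ℝ n) k → (Vector ℝ n → ℝ) → Vector ℝ n → ℝ
  join A N x = ∥ x ∥ ⊔ maximum λ j → N (A j ∗ x)

  opaque
    join-bounded : ∀ {k n} (A : Vector (Matrix ℝ n) k) {N} → BoundedNorm N → BoundedNorm (join A N)
    join-bounded {k} {n} A {N} N-norm = record
      { isNorm = record
        { cong        = λ x≋y → ⊔-cong (∥∥.cong x≋y)
            (maximum-cong λ j → N.cong (∗-cong (A j) x≋y))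
        ; nonneg      = λ x → ≤-trans (∥∥.nonneg x) (x≤x⊔y _ _)
        ; definite    = λ x Nx≈0 → ∥∥.definite x
            (antisym (≤-respʳ-≈ Nx≈0 (x≤x⊔y _ _)) (∥∥.nonneg x))
        ; homogeneous = λ t x → trans
            (⊔-cong (∥∥.homogeneous t x) (trans
              (maximum-cong λ j → trans (N.cong (∗-∙ (A j) t x)) (N.homogeneous t (A j ∗ x)))
              (maximum-* (0≤∣x∣ t) (λ j → N (A j ∗ x)))))
            (sym (*-distrib-⊔ (0≤∣x∣ t) _ _))
        ; triangle    = λ x y → ⊔-lub
            (≤-trans (∥∥.triangle x y) (+-mono-≤ (x≤x⊔y _ _) (x≤x⊔y _ _)))
            (maximum-lub (+-nonneg (≤-trans (∥∥.nonneg x) (x≤x⊔y _ _)) (≤-trans (∥∥.nonneg y) (x≤x⊔y _ _))) λ j →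
              begin
                N (A j ∗ (x ⊕ y))                 ≈⟨ N.cong (∗-distrib-⊕ (A j) x y) ⟩
                N ((A j ∗ x) ⊕ (A j ∗ y))         ≤⟨ N.triangle (A j ∗ x) (A j ∗ y) ⟩
                N (A j ∗ x) + N (A j ∗ y)         ≤⟨ +-mono-≤ (term≤join x j) (term≤join y j) ⟩
                join A N x + join A N y           ∎)
        }
      ; C      = 1# + maximum D
      ; 0≤C    = +-nonneg (<⇒≤ 0<1) (maximum-nonneg D)
      ; N≤C*∥∥ = λ x → ⊔-lub
          (≤-by (maximum D * ∥ x ∥) (*-nonneg (maximum-nonneg D) (∥∥.nonneg x))
            (solve 2 (λ d x → (:1 :+ d) :* x := x :+ d :* x) refl (maximum D) ∥ x ∥))
          (maximum-lub (*-nonneg (+-nonneg (<⇒≤ 0<1) (maximum-nonneg D)) (∥∥.nonneg x)) λ j → begin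
            N (A j ∗ x)                  ≤⟨ N.N≤C*∥∥ (A j ∗ x) ⟩
            N.C * ∥ A j ∗ x ∥            ≤⟨ *-monoˡ-≤ N.C N.0≤C (proj₂ (proj₂ (∗-bounded (A j))) x) ⟩
            N.C * (proj₁ (∗-bounded (A j)) * ∥ x ∥)   ≈⟨ *-assoc _ _ _ ⟨
            D j * ∥ x ∥                  ≤⟨ *-monoʳ-≤ (∥∥.nonneg x) (≤-trans (term≤maximum D j) (≤-by 1# (<⇒≤ 0<1) (+-comm _ _))) ⟩
            (1# + maximum D) * ∥ x ∥     ∎)
      }
      where
      open ≤R
      module N = BoundedNorm N-norm
      D : Vector ℝ k
      D j = N.C * proj₁ (∗-bounded (A j))
      term≤join : ∀ x j → N (A j ∗ x) ≤ join A N x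
      term≤join x j = ≤-trans (term≤maximum (λ j → N (A j ∗ x)) j) (x≤y⊔x _ _)

  -- The maximum of ∥ A_w x ∥ over the words w of length at most i.  If the words
  -- of length i + 1 do not expand ∥_∥, then no A_j expands this norm.
  adapted : ∀ {k n} → Vector (Matrix ℝ n) k → ℕ → Vector ℝ n → ℝ
  adapted A zero    = ∥_∥
  adapted A (suc i) = join A (adapted A i)

  opaque
    adapted-bounded : ∀ {k n} (A : Vector (Matrix ℝ n) k) i → BoundedNorm (adapted A i)
    adapted-bounded A zero    = record
      { isNorm = ∥∥-isNorm
      ; C      = 1#
      ; 0≤C    = <⇒≤ 0<1
      ; N≤C*∥∥ = λ x → ≤-reflexive (sym (*-identityˡ ∥ x ∥))
      }
    adapted-bounded A (suc i) = join-bounded A (adapted-bounded A i)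

  act : ∀ {k n l} → Vector (Matrix ℝ n) k → Vector (Fin k) l → Vector ℝ n → Vector ℝ n
  act {l = zero}  A w x = x
  act {l = suc l} A w x = A (head w) ∗ act A (tail w) x

  -- The matrix applied first belongs to the last letter of a word. `join` adds a matrix at that
  -- end, while `act` recurses from the other one.
  snoc : ∀ {a} {X : Set a} {l} → Vector X l → X → Vector X (suc l)
  snoc {l = zero}  w j = λ _ → j
  snoc {l = suc l} w j = head w ∷ snoc (tail w) j

  opaque
    act-snoc : ∀ {k n l} (A : Vector (Matrix ℝ n) k) (w : Vector (Fin k) l) j x →
      act A (snoc w j) x ≡ act A w (A j ∗ x)
    act-snoc {l = zero}  A w j x = ≡.refl
    act-snoc {l = suc l} A w j x = ≡.cong (A (head w) ∗_) (act-snoc A (tail w) j x)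

    -- Raising the index adds only the words of length i + 1. In the induction,
    -- `adapted A i (A j ∗ x)` is already a term of the given bound, and words of length i + 1
    -- acting on `A j ∗ x` are words of length i + 2 acting on x that end in j.
    adapted-stable : ∀ {k n} (A : Vector (Matrix ℝ n) k) i x {b} → adapted A i x ≤ b →
      (∀ (w : Vector (Fin k) (suc i)) → ∥ act A w x ∥ ≤ b) → adapted A (suc i) x ≤ b
    adapted-stable A zero x {b} ∥x∥≤b words≤b = ⊔-lub ∥x∥≤b
      (maximum-lub (≤-trans (∥∥.nonneg x) ∥x∥≤b) λ j → words≤b λ _ → j)
    adapted-stable A (suc i) x {b} Nx≤b words≤b = ⊔-lub ∥x∥≤b
      (maximum-lub (≤-trans (∥∥.nonneg x) ∥x∥≤b) λ j → adapted-stable A i (A j ∗ x)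
        (≤-trans (≤-trans (term≤maximum (λ j → adapted A i (A j ∗ x)) j) (x≤y⊔x _ _)) Nx≤b)
        λ w → ≡.subst (λ y → ∥ y ∥ ≤ b) (act-snoc A w j x) (words≤b (snoc w j)))
      where
      ∥x∥≤b : ∥ x ∥ ≤ b
      ∥x∥≤b = ≤-trans (x≤x⊔y _ _) Nx≤b

  scaled : ∀ {k n} → ℝ → Vector (Matrix ℝ n) k → Vector (Matrix ℝ n) k
  scaled t B j a b = t * B j a b

  opaque
    scaled-∗ : ∀ {k n} t (B : Vector (Matrix ℝ n) k) j x → scaled t B j ∗ x ≋ t ∙ (B j ∗ x)
    scaled-∗ t B j x i = trans (sum-cong-≋ λ l → *-assoc t (B j i l) (x l))
      (sym (*-distribˡ-sum t (λ l → B j i l * x l)))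

    act-scaled : ∀ {k n l} t (B : Vector (Matrix ℝ n) k) (w : Vector (Fin k) l) x →
      act (scaled t B) w x ≋ t ^ l ∙ (wordProduct B w ∗ x)
    act-scaled {l = zero}  t B w x i = trans (sym (identity-∗ x i)) (sym (*-identityˡ _))
    act-scaled {l = suc l} t B w x i = begin-equality
      (scaled t B (head w) ∗ act (scaled t B) (tail w) x) i        ≈⟨ scaled-∗ t B (head w) _ i ⟩
      t * (B (head w) ∗ act (scaled t B) (tail w) x) i             ≈⟨ *-congˡ (∗-cong (B (head w)) (act-scaled t B (tail w) x) i) ⟩
      t * (B (head w) ∗ (t ^ l ∙ (wordProduct B (tail w) ∗ x))) i  ≈⟨ *-congˡ (∗-∙ (B (head w)) (t ^ l) _ i) ⟩
      t * (t ^ l * (B (head w) ∗ (wordProduct B (tail w) ∗ x)) i)  ≈⟨ *-assoc _ _ _ ⟨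
      t * t ^ l * (B (head w) ∗ (wordProduct B (tail w) ∗ x)) i    ≈⟨ *-congˡ (·-∗ (B (head w)) (wordProduct B (tail w)) x i) ⟨
      t * t ^ l * (wordProduct B w ∗ x) i                          ∎
      where open ≤R

    act-scaled≤∥∥ : ∀ {k n q l} (B : Vector (Matrix ℝ n) k) → 0# < q → ProductsBoundedBy B l (q ^ l) →
      ∀ (w : Vector (Fin k) l) x → ∥ act (scaled (q ⁻¹) B) w x ∥ ≤ ∥ x ∥
    act-scaled≤∥∥ {q = q} {l} B 0<q bounded w x = begin
      ∥ act (scaled (q ⁻¹) B) w x ∥             ≈⟨ ∥∥.cong (act-scaled (q ⁻¹) B w x) ⟩
      ∥ (q ⁻¹) ^ l ∙ (wordProduct B w ∗ x) ∥      ≈⟨ ∥∥.homogeneous _ _ ⟩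
      ∣ (q ⁻¹) ^ l ∣ * ∥ wordProduct B w ∗ x ∥    ≈⟨ *-congʳ (0≤x⇒∣x∣≈x 0≤q⁻ˡ) ⟩
      (q ⁻¹) ^ l * ∥ wordProduct B w ∗ x ∥        ≤⟨ *-monoˡ-≤ _ 0≤q⁻ˡ (bounded w x) ⟩
      (q ⁻¹) ^ l * (q ^ l * ∥ x ∥)                ≈⟨ *-assoc _ _ _ ⟨
      (q ⁻¹) ^ l * q ^ l * ∥ x ∥                  ≈⟨ *-congʳ (^-distrib-* (q ⁻¹) q l) ⟨
      (q ⁻¹ * q) ^ l * ∥ x ∥                    ≤⟨ *-monoʳ-≤ (∥∥.nonneg x) (x^n≤1 l (≤-trans (<⇒≤ 0<1) (≤-reflexive (sym q⁻¹q≈1))) (≤-reflexive q⁻¹q≈1)) ⟩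
      1# * ∥ x ∥                                ≈⟨ *-identityˡ _ ⟩
      ∥ x ∥                                     ∎
      where
      open ≤R
      0≤q⁻ˡ : 0# ≤ (q ⁻¹) ^ l
      0≤q⁻ˡ = ^-nonneg l (<⇒≤ (⁻¹-pos 0<q))
      q⁻¹q≈1 : q ⁻¹ * q ≈ 1#
      q⁻¹q≈1 = trans (*-comm _ _) (x*x⁻¹≈1 0<q)

    ∥∥≤adapted : ∀ {k n} (A : Vector (Matrix ℝ n) k) i x → ∥ x ∥ ≤ adapted A i x
    ∥∥≤adapted A zero    x = ≤-refl
    ∥∥≤adapted A (suc i) x = x≤x⊔y _ _

    -- The left side is one of the terms of `adapted A (suc i) x`, and under the hypothesis the
    -- longer words do not push that maximum above `adapted A i x`.
    adapted-nonexpansive : ∀ {k n} (A : Vector (Matrix ℝ n) k) i →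
      (∀ (w : Vector (Fin k) (suc i)) x → ∥ act A w x ∥ ≤ ∥ x ∥) →
      ∀ j x → adapted A i (A j ∗ x) ≤ adapted A i x
    adapted-nonexpansive A i words≤ j x = begin
      adapted A i (A j ∗ x)   ≤⟨ ≤-trans (term≤maximum (λ j → adapted A i (A j ∗ x)) j) (x≤y⊔x _ _) ⟩
      adapted A (suc i) x     ≤⟨ adapted-stable A i x ≤-refl (λ w → ≤-trans (words≤ w x) (∥∥≤adapted A i x)) ⟩
      adapted A i x           ∎
      where open ≤R

    -- The adapted norm is built for the matrices divided by q, which makes them nonexpanding.
    -- Dividing by ρ instead leaves over the factor q / ρ < 1, the contraction ratio.
    contractingNorm : ∀ {k n} (B : Vector (Matrix ℝ n) k) {ρ* ρ} →
      IsJointSpectralRadius B ρ* → ρ* < ρ →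
      ∃[ N ] BoundedNorm N × ∃[ c ] 0# ≤ c × c < 1# × (∀ j x → N (ρ ⁻¹ ∙ (B j ∗ x)) ≤ c * N x)
    contractingNorm {k} {n} B {ρ = ρ} jsr ρ*<ρ with jsr-uniform B jsr ρ*<ρ
    ... | q , 0<q , q<ρ , l , bounded =
      N , adapted-bounded A l , q * ρ ⁻¹ , 0≤c , x/y<1 0<ρ q<ρ , λ j x → begin
        N (ρ ⁻¹ ∙ (B j ∗ x))             ≈⟨ N.cong (rescale j x) ⟩
        N ((q * ρ ⁻¹) ∙ (A j ∗ x))         ≈⟨ N.homogeneous _ _ ⟩
        ∣ q * ρ ⁻¹ ∣ * N (A j ∗ x)       ≈⟨ *-congʳ (0≤x⇒∣x∣≈x 0≤c) ⟩
        q * ρ ⁻¹ * N (A j ∗ x)           ≤⟨ *-monoˡ-≤ _ 0≤c (adapted-nonexpansive A l (act-scaled≤∥∥ B 0<q bounded) j x) ⟩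
        q * ρ ⁻¹ * N x                   ∎
      where
      open ≤R
      0<ρ : 0# < ρ
      0<ρ = ≤-<-trans (<⇒≤ 0<q) q<ρ
      0≤c : 0# ≤ q * ρ ⁻¹
      0≤c = *-nonneg (<⇒≤ 0<q) (<⇒≤ (⁻¹-pos 0<ρ))
      A : Vector (Matrix ℝ n) k
      A = scaled (q ⁻¹) B
      N : Vector ℝ n → ℝ
      N = adapted A l
      module N = BoundedNorm (adapted-bounded A l)
      rescale : ∀ j x → ρ ⁻¹ ∙ (B j ∗ x) ≋ (q * ρ ⁻¹) ∙ (A j ∗ x)
      rescale j x i = begin-equality
        ρ ⁻¹ * (B j ∗ x) i                       ≈⟨ *-identityˡ _ ⟨
        1# * (ρ ⁻¹ * (B j ∗ x) i)                ≈⟨ *-congʳ (x*x⁻¹≈1 0<q) ⟨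
        q * q ⁻¹ * (ρ ⁻¹ * (B j ∗ x) i)          ≈⟨ solve 4 (λ q i r y → q :* i :* (r :* y) := q :* r :* (i :* y)) refl q (q ⁻¹) (ρ ⁻¹) _ ⟩
        q * ρ ⁻¹ * (q ⁻¹ * (B j ∗ x) i)          ≈⟨ *-congˡ (scaled-∗ (q ⁻¹) B j x i) ⟨
        q * ρ ⁻¹ * (A j ∗ x) i                   ∎

-- Norms on the product space and consequences of compactness.

module Compactness (em : ExcludedMiddle 0ℓ) (R : CompleteOrderedField) where
  open CompleteOrderedField R hiding (zero)
  open Analysis R
  open LinearAlgebra rawRing
  open OrderedFieldProperties em R
  open Norms em R
  open AdaptedNorm em R

  prepend : ∀ {n} → (Vector ℝ n → ℝ) → Vector ℝ (suc n) → ℝ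
  prepend N x = ∣ head x ∣ + N (tail x)

  opaque
    prepend-bounded : ∀ {n} {N : Vector ℝ n → ℝ} → BoundedNorm N → BoundedNorm (prepend N)
    prepend-bounded {n} {N} N-norm = record
      { isNorm = record
        { cong        = λ x≋y → +-cong (∣∣-cong (x≋y zero)) (N.cong (x≋y ∘ suc))
        ; nonneg      = λ x → +-nonneg (0≤∣x∣ _) (N.nonneg _)
        ; definite    = definite
        ; homogeneous = λ t x → trans (+-cong (∣xy∣≈∣x∣∣y∣ t (head x)) (N.homogeneous t (tail x)))
                                      (sym (distribˡ ∣ t ∣ _ _))
        ; triangle    = λ x y → ≤-trans
            (+-mono-≤ (∣x+y∣≤∣x∣+∣y∣ (head x) (head y)) (N.triangle (tail x) (tail y)))
            (≤-reflexive (solve 4 (λ a b c d → (a :+ b) :+ (c :+ d) := (a :+ c) :+ (b :+ d)) refl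
              ∣ head x ∣ ∣ head y ∣ (N (tail x)) (N (tail y))))
        }
      ; C      = 1# + N.C
      ; 0≤C    = +-nonneg (<⇒≤ 0<1) N.0≤C
      ; N≤C*∥∥ = λ x → begin
          ∣ head x ∣ + N (tail x)                    ≤⟨ +-mono-≤ ≤-refl (N.N≤C*∥∥ (tail x)) ⟩
          ∣ head x ∣ + N.C * ∥ tail x ∥              ≤⟨ ≤-by (N.C * ∣ head x ∣ + ∥ tail x ∥)
                                                       (+-nonneg (*-nonneg N.0≤C (0≤∣x∣ _)) (∥∥.nonneg _))
                                                       (solve 3 (λ a c t → (:1 :+ c) :* (a :+ t) := (a :+ c :* t) :+ (c :* a :+ t)) refl ∣ head x ∣ N.C ∥ tail x ∥) ⟩
          (1# + N.C) * (∣ head x ∣ + ∥ tail x ∥)     ≈⟨ *-congˡ (∥∥-uncons x) ⟨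
          (1# + N.C) * ∥ x ∥                         ∎
      }
      where
      open ≤R
      module N = BoundedNorm N-norm
      definite : ∀ x → prepend N x ≈ 0# → x ≋ 𝟎
      definite x Nx≈0 zero    = ∣x∣≈0⇒x≈0 (antisym
        (≤-respʳ-≈ Nx≈0 (≤-by _ (N.nonneg (tail x)) refl)) (0≤∣x∣ (head x)))
      definite x Nx≈0 (suc i) = N.definite (tail x) (antisym
        (≤-respʳ-≈ Nx≈0 (≤-by _ (0≤∣x∣ (head x)) (+-comm _ _))) (N.nonneg (tail x))) i

  -- A predicate on vectors need not be stable under `_≋_`. Open sets are, since a ball contains
  -- everything equal to its centre, and so are invariant sets, since `Image` is closed under `_≋_`.
  RespectsEquality : ∀ {n} → Pred (Vector ℝ n) 0ℓ → Set
  RespectsEquality K = ∀ {x y} → x ≋ y → x ∈ K → y ∈ K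

  opaque
    open-respects : ∀ {n} {U : Pred (Vector ℝ n) 0ℓ} → IsOpen U → RespectsEquality U
    open-respects {U = U} U-open {x} {y} x≋y x∈U =
      let (ε , 0<ε , ball⊆U) = U-open x x∈U in
      ball⊆U (≤-<-trans (≤-reflexive (sum-zero λ i →
        trans (*-congʳ (trans (+-congʳ (sym (x≋y i))) (-‿inverseʳ (x i)))) (zeroˡ _))) (*-pos 0<ε 0<ε))

  opaque
    Any-<⇒bounded : (rs : List ℝ) → ∃[ D ] (∀ t → Any (t <_) rs → t ≤ D)
    Any-<⇒bounded List.[]       = 0# , λ _ ()
    Any-<⇒bounded (r List.∷ rs) = let (D , t≤D) = Any-<⇒bounded rs in
      r ⊔ D , λ { t (here t<r)  → ≤-trans (<⇒≤ t<r) (x≤x⊔y r D)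
                ; t (there any) → ≤-trans (t≤D t any) (x≤y⊔x r D) }

    Any->⇒bounded : (es : List (∃[ ε ] 0# < ε)) →
      ∃[ ε ] 0# < ε × (∀ t → Any (λ e → proj₁ e < t) es → ε < t)
    Any->⇒bounded List.[]              = 1# , 0<1 , λ _ ()
    Any->⇒bounded ((e , 0<e) List.∷ es) =
      let (ε , 0<ε , ε<t)            = Any->⇒bounded es
          (δ , 0<δ , δ≤e , δ≤ε) = min₂ 0<e 0<ε in
      δ , 0<δ , λ { t (here e<t)  → ≤-<-trans δ≤e e<t
                  ; t (there any) → ≤-<-trans δ≤ε (ε<t t any) }

  -- Compact sets are bounded and closed; comparison of invariant compact sets.

  module _ {n} {N : Vector ℝ n → ℝ} (N-norm : BoundedNorm N) where
    private module N = BoundedNorm N-norm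

    norm-continuous : ∀ {η} → 0# < η → ∃[ ε ] 0# < ε × (∀ x y → Ball x ε y → N (y ⊖ x) < η)
    norm-continuous {η} 0<η =
      let (ε , 0<ε , _ , Cnε<η) = small-multiple (*-nonneg N.0≤C (0≤fromℕ n)) 0<η 0<1 in
      ε , 0<ε , λ x y y∈B → ≤-<-trans (begin
        N (y ⊖ x)               ≤⟨ N.N≤C*∥∥ (y ⊖ x) ⟩
        N.C * ∥ y ⊖ x ∥         ≤⟨ *-monoˡ-≤ N.C N.0≤C (ball⇒∥∥≤ x y 0<ε y∈B) ⟩
        N.C * (fromℕ n * ε)     ≈⟨ *-assoc _ _ _ ⟨
        N.C * fromℕ n * ε       ∎) Cnε<η
      where open ≤R

    norm-triangle : ∀ x y z → N (x ⊖ z) ≤ N (x ⊖ y) + N (y ⊖ z)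
    norm-triangle x y z = ≤-trans
      (≤-reflexive (N.cong λ i → solve 3 (λ x y z → x :- z := (x :- y) :+ (y :- z)) refl (x i) (y i) (z i)))
      (N.triangle (x ⊖ y) (y ⊖ z))

    ball-open : ∀ q r → IsOpen (λ p → N (p ⊖ q) < r)
    ball-open q r p p∈U =
      let (ε , 0<ε , close) = norm-continuous (0<y-x p∈U) in
      ε , 0<ε , λ {y} y∈B → ≤-<-trans (norm-triangle y p q)
        (<-≤-trans (+-mono-< (close p y y∈B) ≤-refl)
          (≤-reflexive (solve 2 (λ r t → (r :- t) :+ t := r) refl r (N (p ⊖ q)))))

    outside-open : ∀ p r → IsOpen (λ q → r < N (p ⊖ q))
    outside-open p r q q∈U =
      let (ε , 0<ε , close) = norm-continuous (0<y-x q∈U) in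
      ε , 0<ε , λ {y} y∈B → <-by
        ((N (p ⊖ q) - r - N (y ⊖ q)) + (N (p ⊖ y) + N (y ⊖ q) - N (p ⊖ q)))
        (+-pos (0<y-x (close q y y∈B)) (0≤y-x (norm-triangle p y q)))
        (solve 4 (λ r a b c → b := r :+ ((a :- r :- c) :+ (b :+ c :- a))) refl
          r (N (p ⊖ q)) (N (p ⊖ y)) (N (y ⊖ q)))

    -- The open N-balls around q of all radii cover K, and the largest radius in a finite subcover
    -- is a bound.
    compact-bounded : ∀ {K} → IsCompact K → ∀ q → ∃[ D ] (∀ {p} → p ∈ K → N (p ⊖ q) ≤ D)
    compact-bounded {K} K-compact q =
      let (rs , covered) = K-compact ℝ (λ r p → N (p ⊖ q) < r) (ball-open q)
                             (λ {p} _ → N (p ⊖ q) + 1# , <-+ 0<1)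
          (D , t≤D)      = Any-<⇒bounded rs in
      D , λ {p} p∈K → t≤D (N (p ⊖ q)) (covered p∈K)

    norm-pos : ∀ {x y} → ¬ x ≋ y → 0# < N (x ⊖ y)
    norm-pos {x} {y} x≋̸y = N.nonneg _ , λ 0≈N → x≋̸y λ i →
      x∙y⁻¹≈ε⇒x≈y (x i) (y i) (N.definite (x ⊖ y) (sym 0≈N) i)

    -- If p is not in K, the exteriors of the closed N-balls around p cover K, each q being caught
    -- at half its distance. A finite subcover then keeps K at a fixed positive distance from p.
    compact-closed : ∀ {K} → IsCompact K → RespectsEquality K →
      ∀ {p} → (∀ ε → 0# < ε → ∃[ q ] q ∈ K × N (p ⊖ q) < ε) → p ∈ K
    compact-closed {K} K-compact K-resp {p} approached with em {p ∈ K}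
    ... | yes p∈K = p∈K
    ... | no  p∉K =
      let (es , covered)  = K-compact (∃[ ε ] 0# < ε) (λ e q → proj₁ e < N (p ⊖ q))
                              (λ e → outside-open p (proj₁ e))
                              (λ {q} q∈K → let 0<N = norm-pos λ p≋q → p∉K (K-resp (sym ∘ p≋q) q∈K) in
                                (½ * N (p ⊖ q) , *-pos 0<½ 0<N) , half-< 0<N)
          (ε , 0<ε , ε<t) = Any->⇒bounded es
          (q , q∈K , N<ε) = approached ε 0<ε in
      ⊥-elim (<⇒≱ (ε<t (N (p ⊖ q)) (covered q∈K)) (<⇒≤ N<ε))

    module _ {k} {S : Vector (Vector ℝ n → Vector ℝ n) k} {c} (0≤c : 0# ≤ c) (c<1 : c < 1#)
             (contraction : ∀ j x y → N (S j x ⊖ S j y) ≤ c * N (x ⊖ y)) where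

      -- Invariance of K traces p back through m maps to some point of K. Applying the same maps to
      -- `q₀` stays inside L, and each application shrinks the initial distance, at most D, by the
      -- factor c.
      approximation : ∀ {K L : Pred (Vector ℝ n) 0ℓ} →
        K ⊆ (⋃[ j ∶ Fin k ] Image (S j) K) → (⋃[ j ∶ Fin k ] Image (S j) L) ⊆ L →
        ∀ {q₀ D} → q₀ ∈ L → (∀ {p} → p ∈ K → N (p ⊖ q₀) ≤ D) →
        ∀ m {p} → p ∈ K → ∃[ q ] q ∈ L × N (p ⊖ q) ≤ c ^ m * D
      approximation K⊆ ⊆L q₀∈L bound zero p∈K =
        _ , q₀∈L , ≤-trans (bound p∈K) (≤-reflexive (sym (*-identityˡ _)))
      approximation K⊆ ⊆L {D = D} q₀∈L bound (suc m) {p} p∈K =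
        let (j , p′ , p′∈K , Sp′≋p) = K⊆ p∈K
            (q′ , q′∈L , close)    = approximation K⊆ ⊆L q₀∈L bound m p′∈K in
        S j q′ , ⊆L (j , q′ , q′∈L , λ _ → refl) , (begin
          N (p ⊖ S j q′)           ≈⟨ N.cong (λ i → +-congʳ (sym (Sp′≋p i))) ⟩
          N (S j p′ ⊖ S j q′)      ≤⟨ contraction j p′ q′ ⟩
          c * N (p′ ⊖ q′)          ≤⟨ *-monoˡ-≤ c 0≤c close ⟩
          c * (c ^ m * D)          ≈⟨ *-assoc _ _ _ ⟨
          c * c ^ m * D            ∎)
        where open ≤R

      invariant-⊆ : ∀ {K L : Pred (Vector ℝ n) 0ℓ} → IsCompact K → Satisfiable L → IsCompact L →
        K ⊆ (⋃[ j ∶ Fin k ] Image (S j) K) →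
        L ⊆ (⋃[ j ∶ Fin k ] Image (S j) L) → (⋃[ j ∶ Fin k ] Image (S j) L) ⊆ L →
        K ⊆ L
      invariant-⊆ {K} {L} K-compact (q₀ , q₀∈L) L-compact K⊆ L⊆ ⊆L {p} p∈K =
        compact-closed L-compact L-resp λ ε 0<ε →
          let (D , bound)                 = compact-bounded K-compact q₀
              0≤D                         = ≤-trans (N.nonneg _) (bound p∈K)
              (δ , 0<δ , _ , Dδ<ε)        = small-multiple 0≤D 0<ε 0<1
              (m , c^m<δ)                 = c^n<ε 0≤c c<1 0<δ
              (q , q∈L , close)           = approximation K⊆ ⊆L q₀∈L bound m p∈K in
          q , q∈L , ≤-<-trans close (≤-<-trans (*-monoʳ-≤ 0≤D (<⇒≤ c^m<δ))
            (≤-<-trans (≤-reflexive (*-comm δ D)) Dδ<ε))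
        where
        -- A point of L is equal to some `S j x′`, and then so is every vector equal to it;
        -- invariance returns that vector to L.
        L-resp : RespectsEquality L
        L-resp x≋y x∈L = let (j , x′ , x′∈L , Sx′≋x) = L⊆ x∈L in
          ⊆L (j , x′ , x′∈L , λ i → trans (Sx′≋x i) (x≋y i))

  -- Compactness of the unit interval and of the graph.

  -- The set whose supremum drives the Heine-Borel argument; the condition t ≤ 1 supplies its upper
  -- bound.
  InitialCover : ∀ {I : Set} → (I → ℝ → Set) → ℝ → Set
  InitialCover {I} V t = (0# ≤ t × t ≤ 1#) ×
    Σ[ is ∈ List I ] (∀ y → 0# ≤ y → y ≤ t → Any (λ i → V i y) is)

  -- This is what an open cover of the graph becomes when pulled back along `x ↦ x ∷ F x`.
  LocallyCovered : ∀ {I : Set} → (I → ℝ → Set) → Set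
  LocallyCovered V = ∀ x → 0# ≤ x → x ≤ 1# →
    ∃[ i ] ∃[ δ ] 0# < δ × (∀ y → ∣ y - x ∣ < δ → V i y)

  opaque
    initialCover-0 : ∀ {I : Set} {V : I → ℝ → Set} → LocallyCovered V → InitialCover V 0#
    initialCover-0 local = let (i , δ , 0<δ , near) = local 0# ≤-refl (<⇒≤ 0<1) in
      (≤-refl , <⇒≤ 0<1) , i List.∷ List.[] , λ y 0≤y y≤0 → here (near y
        (≤-<-trans (∣x∣≤ (≤-respʳ-≈ (-‿inverseʳ 0#) (+-monoˡ-≤ (- 0#) y≤0))
                         (≤-by y 0≤y (solve 1 (λ y → :0 := :- (y :- :0) :+ y) refl y))) 0<δ))

    -- A cover of [0, t] together with the set covering the δ-neighbourhood of s
    -- covers [0, s + δ/2], provided s - δ < t.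
    initialCover-extend : ∀ {I : Set} {V : I → ℝ → Set} {s i δ t} → 0# ≤ s → 0# < δ →
      (∀ y → ∣ y - s ∣ < δ → V i y) → InitialCover V t → s - δ < t →
      ∀ {r} → 0# ≤ r → r ≤ 1# → r ≤ s + ½ * δ → InitialCover V r
    initialCover-extend {V = V} {s} {i} {δ} {t} 0≤s 0<δ near (_ , is , covered) s-δ<t {r} 0≤r r≤1 r≤s+ =
      (0≤r , r≤1) , i List.∷ is , λ y 0≤y y≤r → extend y 0≤y y≤r (≤-or-> y t)
      where
      extend : ∀ y → 0# ≤ y → y ≤ r → y ≤ t ⊎ t < y → Any (λ i → V i y) (i List.∷ is)
      extend y 0≤y y≤r (inj₁ y≤t) = there (covered y 0≤y y≤t)
      extend y 0≤y y≤r (inj₂ t<y) = here (near y (∣x∣<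
        (≤-<-trans (≤-by _ (0≤y-x (≤-trans y≤r r≤s+))
            (solve 3 (λ y s h → h := (y :- s) :+ (s :+ h :- y)) refl y s (½ * δ))) (half-< 0<δ))
        (<-by _ (0<y-x (≤-<-trans (<⇒≤ s-δ<t) t<y))
            (solve 3 (λ y s d → d := :- (y :- s) :+ (y :- (s :- d))) refl y s δ))))

    -- Let s be the supremum of the t with [0, t] finitely covered, and δ the radius available at s.
    -- Some such t exceeds s - δ, since s - δ is no upper bound. If s + δ/2 ≤ 1, the extended cover
    -- would pass beyond s; hence s + δ/2 > 1 and the extension reaches 1.
    interval-compact : ∀ {I : Set} (V : I → ℝ → Set) → LocallyCovered V →
      Σ[ is ∈ List I ] (∀ y → 0# ≤ y → y ≤ 1# → Any (λ i → V i y) is)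
    interval-compact V local =
      let (s , s-ub , s-least) = complete (InitialCover V) (0# , initialCover-0 local) (1# , λ t P → proj₂ (proj₁ P))
          0≤s                  = s-ub 0# (initialCover-0 local)
          s≤1                  = s-least 1# (λ t P → proj₂ (proj₁ P))
      in reach s-ub s-least 0≤s (local s 0≤s s≤1)
      where
      reach : ∀ {s} → IsUpperBound (InitialCover V) s → (∀ b → IsUpperBound (InitialCover V) b → s ≤ b) →
        0# ≤ s → (∃[ i ] ∃[ δ ] 0# < δ × (∀ y → ∣ y - s ∣ < δ → V i y)) →
        Σ[ is ∈ _ ] (∀ y → 0# ≤ y → y ≤ 1# → Any (λ i → V i y) is)
      reach {s} s-ub s-least 0≤s (i , δ , 0<δ , near) with em {∃[ t ] InitialCover V t × s - δ < t}
      ... | no ¬p = ⊥-elim (<⇒≱ (<-by δ 0<δ (solve 2 (λ s d → s := (s :- d) :+ d) refl s δ))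
              (s-least (s - δ) λ t t∈P → ≮⇒≥ λ s-δ<t → ¬p (t , t∈P , s-δ<t)))
      ... | yes (t , t∈P , s-δ<t) with ≤-or-> (s + ½ * δ) 1#
      ... | inj₁ s+≤1 = ⊥-elim (<⇒≱ (<-+ 0<½δ) (s-ub (s + ½ * δ)
              (initialCover-extend 0≤s 0<δ near t∈P s-δ<t (+-nonneg 0≤s (<⇒≤ 0<½δ)) s+≤1 ≤-refl)))
        where
        0<½δ : 0# < ½ * δ
        0<½δ = *-pos 0<½ 0<δ
      ... | inj₂ 1<s+ = proj₂ (initialCover-extend 0≤s 0<δ near t∈P s-δ<t (<⇒≤ 0<1) ≤-refl (<⇒≤ 1<s+))

    -- Both coordinates are kept within ε/2, and the sum of the two squares is below ε² because
    -- (ε/2)² + (ε/2)² is at most the square of the sum.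
    graph-continuous : ∀ {n} {F : ℝ → Vector ℝ n} → IsContinuous F → ∀ x {ε} → 0# < ε →
      ∃[ δ ] 0# < δ × (∀ y → ∣ y - x ∣ < δ → Ball (x ∷ F x) ε (y ∷ F y))
    graph-continuous {F = F} F-cont x {ε} 0<ε =
      let 0<h                   = *-pos 0<½ 0<ε
          (δ′ , 0<δ′ , close)   = F-cont x (½ * ε) 0<h
          (δ , 0<δ , δ≤δ′ , δ≤h) = min₂ 0<δ′ 0<h in
      δ , 0<δ , λ y y-x<δ → begin-strict
        (y - x) * (y - x) + normSquared (F y ⊖ F x)     ≈⟨ +-comm _ _ ⟩
        normSquared (F y ⊖ F x) + (y - x) * (y - x)     <⟨ +-mono-< (close y (<-≤-trans y-x<δ δ≤δ′))
                                                             (∣x∣≤y⇒x²≤y² (≤-trans (<⇒≤ y-x<δ) δ≤h)) ⟩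
        ½ * ε * (½ * ε) + ½ * ε * (½ * ε)               ≤⟨ ≤-by _ (+-nonneg (0≤x² (½ * ε)) (0≤x² (½ * ε)))
                                                             (solve 1 (λ h → (h :+ h) :* (h :+ h) := (h :* h :+ h :* h) :+ (h :* h :+ h :* h)) refl (½ * ε)) ⟩
        (½ * ε + ½ * ε) * (½ * ε + ½ * ε)               ≈⟨ *-cong (half+half ε) (half+half ε) ⟩
        ε * ε                                           ∎
      where open ≤R

    graph-compact : ∀ {n} {F : ℝ → Vector ℝ n} → IsContinuous F → IsCompact (Graph F)
    graph-compact {F = F} F-cont I U U-open cover =
      let (is , covered) = interval-compact (λ i x → U i (x ∷ F x)) λ x 0≤x x≤1 →
            let (i , x∈Ui)           = cover (x , 0≤x , x≤1 , λ _ → refl)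
                (ε , 0<ε , ball⊆Ui)  = U-open i _ x∈Ui
                (δ , 0<δ , close)    = graph-continuous {F = F} F-cont x 0<ε in
            i , δ , 0<δ , λ y y-x<δ → ball⊆Ui (close y y-x<δ)
      in is , λ (x , 0≤x , x≤1 , p≋) →
        -- A point of `Graph F` is only `_≋_` to `x ∷ F x`, so membership is carried over by
        -- openness.
        Any.map (λ {i} → open-respects (U-open i) (sym ∘ p≋)) (covered x 0≤x x≤1)

-- Digits, the maps of the system and the graph as their attractor.

module Attractor (em : ExcludedMiddle 0ℓ) (R : CompleteOrderedField) where
  open CompleteOrderedField R hiding (zero)
  open Analysis R
  open LinearAlgebra rawRing
  open OrderedFieldProperties em R
  open Norms em R
  open AdaptedNorm em R
  open Compactness em R

  -- F is a bare function on the carrier. For x ≈ y the distance of the arguments is 0, below every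
  -- δ, so the values differ by at most every ε > 0.
  continuous⇒cong : ∀ {n} {F : ℝ → Vector ℝ n} → IsContinuous F → ∀ {x y} → x ≈ y → F x ≋ F y
  continuous⇒cong {F = F} F-cont {x} {y} x≈y i = sym (x∙y⁻¹≈ε⇒x≈y (F y i) (F x i) (∣x∣≈0⇒x≈0
    (antisym (≤-ε⇒≤ λ ε 0<ε → ≤-respʳ-≈ (sym (+-identityˡ ε)) (near ε 0<ε)) (0≤∣x∣ _))))
    where
    near : ∀ ε → 0# < ε → ∣ F y i - F x i ∣ ≤ ε
    near ε 0<ε = let (δ , 0<δ , close) = F-cont x ε 0<ε in
      <⇒≤ (ball⇒∣∣< (F x) (F y) 0<ε (close y (≤-<-trans (≤-reflexive
        (trans (∣∣-cong (trans (+-congʳ (sym x≈y)) (-‿inverseʳ x))) (0≤x⇒∣x∣≈x ≤-refl))) 0<δ)) i)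

  -- This brings the right side of the dilation equation into the shape of `ifs`: one linear term
  -- for the digit j and a translation collected from the smaller digits.
  sum-truncate : ∀ {k} (f : Vector ℝ k) j → (∀ a → toℕ j ℕ.< toℕ a → f a ≈ 0#) →
    sum f ≈ f j + sum {toℕ j} (λ a → f (inject {i = j} a))
  sum-truncate f zero    f≈0 = +-congˡ (sum-zero λ a → f≈0 (suc a) (ℕ.s≤s ℕ.z≤n))
  sum-truncate f (suc j) f≈0 = trans
    (+-congˡ (sum-truncate (tail f) j λ a j<a → f≈0 (suc a) (ℕ.s≤s j<a)))
    (solve 3 (λ a b c → a :+ (b :+ c) := b :+ (a :+ c)) refl (head f) _ _)

  fromℕ-< : ∀ {m n} → m ℕ.< n → 1# ≤ fromℕ n - fromℕ m
  fromℕ-< {m} {n} m<n = ≤-by _ (0≤y-x (fromℕ-mono-≤ m<n))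
    (solve 2 (λ m n → n :- m := :1 :+ (n :- (:1 :+ m))) refl (fromℕ m) (fromℕ n))

  locate : ∀ k t → 0# ≤ t → t ≤ fromℕ (suc k) →
    ∃[ j ] fromℕ (toℕ {suc k} j) ≤ t × t ≤ fromℕ (suc (toℕ j))
  locate zero    t 0≤t t≤1 = zero , 0≤t , t≤1
  locate (suc k) t 0≤t t≤k with total t (fromℕ 1)
  ... | inj₁ t≤1 = zero , 0≤t , t≤1
  ... | inj₂ 1≤t =
    let (j , j≤t-1 , t-1≤1+j) = locate k (t - 1#)
          (≤-respʳ-≈ (+-congˡ (-‿cong (+-identityʳ 1#))) (0≤y-x 1≤t))
          (≤-by _ (0≤y-x t≤k) (solve 2 (λ t m → m := (t :- :1) :+ ((:1 :+ m) :- t)) refl t (fromℕ (suc k)))) in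
    suc j
    , ≤-by _ (0≤y-x j≤t-1) (solve 2 (λ t m → t := (:1 :+ m) :+ (t :- :1 :- m)) refl t (fromℕ (toℕ j)))
    , ≤-by _ (0≤y-x t-1≤1+j) (solve 2 (λ t m → :1 :+ m := t :+ (m :- (t :- :1))) refl t (fromℕ (suc (toℕ j))))

  -- Affinity and contraction of the maps; the number of digits is `suc k`.

  module _ {k n} (B : Vector (Matrix ℝ n) (suc k)) (ρ : ℝ) (v : Vector ℝ n) where

    private
      S : Vector (Vector ℝ (suc n) → Vector ℝ (suc n)) (suc k)
      S = ifs B ρ v
      K : ℝ
      K = fromℕ (suc k)
      0<K⁻¹ : 0# < K ⁻¹
      0<K⁻¹ = ⁻¹-pos (0<fromℕ k)
      shift : Fin (suc k) → Vector ℝ n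
      shift j = sumⱽ {toℕ j} λ a → ρ ⁻¹ ∙ (B (inject {i = j} a) ∗ v)

    ifs-cong : ∀ j {p q} → p ≋ q → S j p ≋ S j q
    ifs-cong j p≋q zero    = *-congʳ (+-congʳ (p≋q zero))
    ifs-cong j p≋q (suc i) = +-congʳ (*-congˡ (∗-cong (B j) (p≋q ∘ suc) i))

    ifs-affine : ∀ j → IsAffine (S j)
    ifs-affine j = A , (fromℕ (toℕ j) * K ⁻¹) ∷ shift j , agrees
      where
      open ≤R
      A : Matrix ℝ (suc n)
      A zero    = K ⁻¹ ∷ 𝟎
      A (suc i) = 0# ∷ (ρ ⁻¹ ∙ B j i)
      agrees : ∀ x → S j x ≋ (A ∗ x) ⊕ ((fromℕ (toℕ j) * K ⁻¹) ∷ shift j)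
      agrees x zero = begin-equality
        (head x + fromℕ (toℕ j)) * K ⁻¹                      ≈⟨ solve 3 (λ x j i → (x :+ j) :* i := (i :* x :+ :0) :+ j :* i) refl (head x) (fromℕ (toℕ j)) (K ⁻¹) ⟩
        (K ⁻¹ * head x + 0#) + fromℕ (toℕ j) * K ⁻¹          ≈⟨ +-congʳ (+-congˡ (sum-zero λ l → zeroˡ (tail x l))) ⟨
        (A ∗ x) zero + fromℕ (toℕ j) * K ⁻¹                  ∎
      agrees x (suc i) = +-congʳ (begin-equality
        ρ ⁻¹ * (B j ∗ tail x) i                              ≈⟨ *-distribˡ-sum (ρ ⁻¹) (λ l → B j i l * tail x l) ⟩
        sum (λ l → ρ ⁻¹ * (B j i l * tail x l))              ≈⟨ sum-cong-≋ (λ l → *-assoc (ρ ⁻¹) (B j i l) (tail x l)) ⟨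
        sum (λ l → ρ ⁻¹ * B j i l * tail x l)                ≈⟨ trans (+-congʳ (zeroˡ (head x))) (+-identityˡ _) ⟨
        (A ∗ x) (suc i)                                      ∎)

    -- The linear part is block diagonal, so the larger of the ratios c and 1 / K works for the sum
    -- of the two norms. At least two digits are what makes 1 / K less than 1.
    ifs-contraction : 1 ℕ.≤ k → ∀ {N c} → BoundedNorm N → 0# ≤ c → c < 1# →
      (∀ j x → N (ρ ⁻¹ ∙ (B j ∗ x)) ≤ c * N x) →
      ∃[ c′ ] 0# ≤ c′ × c′ < 1# × (∀ j x y → prepend N (S j x ⊖ S j y) ≤ c′ * prepend N (x ⊖ y))
    ifs-contraction 1≤k {N} {c} N-norm 0≤c c<1 contract =
      c ⊔ K ⁻¹ , ≤-trans 0≤c (x≤x⊔y _ _) , ⊔-lub-< c<1 K⁻¹<1 , λ j x y → begin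
        ∣ head (S j x) - head (S j y) ∣ + N (tail (S j x) ⊖ tail (S j y))
          ≈⟨ +-cong (head-eq j x y) (N.cong (tail-eq j x y)) ⟩
        K ⁻¹ * ∣ head x - head y ∣ + N (ρ ⁻¹ ∙ (B j ∗ (tail x ⊖ tail y)))
          ≤⟨ +-mono-≤ (*-monoʳ-≤ (0≤∣x∣ _) (x≤y⊔x _ _))
                      (≤-trans (contract j (tail x ⊖ tail y)) (*-monoʳ-≤ (N.nonneg _) (x≤x⊔y _ _))) ⟩
        (c ⊔ K ⁻¹) * ∣ head x - head y ∣ + (c ⊔ K ⁻¹) * N (tail x ⊖ tail y)
          ≈⟨ distribˡ _ _ _ ⟨
        (c ⊔ K ⁻¹) * prepend N (x ⊖ y)
          ∎
      where
      open ≤R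
      module N = BoundedNorm N-norm
      K⁻¹<1 : K ⁻¹ < 1#
      K⁻¹<1 = ≤-<-trans (≤-reflexive (sym (*-identityˡ _)))
        (x/y<1 (0<fromℕ k) (<-≤-trans (<-+ 0<1)
          (≤-respˡ-≈ (+-congˡ (+-identityʳ 1#)) (fromℕ-mono-≤ (ℕ.s≤s 1≤k)))))
      head-eq : ∀ j x y → ∣ head (S j x) - head (S j y) ∣ ≈ K ⁻¹ * ∣ head x - head y ∣
      head-eq j x y = begin-equality
        ∣ head (S j x) - head (S j y) ∣       ≈⟨ ∣∣-cong (solve 4 (λ x y j i → (x :+ j) :* i :- (y :+ j) :* i := i :* (x :- y)) refl (head x) (head y) (fromℕ (toℕ j)) (K ⁻¹)) ⟩
        ∣ K ⁻¹ * (head x - head y) ∣          ≈⟨ ∣xy∣≈∣x∣∣y∣ _ _ ⟩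
        ∣ K ⁻¹ ∣ * ∣ head x - head y ∣        ≈⟨ *-congʳ (0≤x⇒∣x∣≈x (<⇒≤ 0<K⁻¹)) ⟩
        K ⁻¹ * ∣ head x - head y ∣            ∎
      tail-eq : ∀ j x y → tail (S j x) ⊖ tail (S j y) ≋ ρ ⁻¹ ∙ (B j ∗ (tail x ⊖ tail y))
      tail-eq j x y i = begin-equality
        tail (S j x) i - tail (S j y) i                      ≈⟨ solve 4 (λ r a b w → (r :* a :+ w) :- (r :* b :+ w) := r :* (a :- b)) refl (ρ ⁻¹) ((B j ∗ tail x) i) ((B j ∗ tail y) i) (shift j i) ⟩
        ρ ⁻¹ * ((B j ∗ tail x) i - (B j ∗ tail y) i)         ≈⟨ *-congˡ (∗-distrib-⊖ (B j) (tail x) (tail y) i) ⟨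
        ρ ⁻¹ * (B j ∗ (tail x ⊖ tail y)) i                   ∎

    -- The dilation equation, invariance of the graph and the attractor.

    module _ {F : ℝ → Vector ℝ n} (F-sol : IsDilationSolution B ρ v F) where
      open IsDilationSolution F-sol

      -- For y = (x + j) / k the argument k y - a of the dilation equation is
      -- x + (j - a), so that F takes its boundary values v and 0 for a ≠ j.
      graph-step : ∀ j {x y} → 0# ≤ x → x ≤ 1# → K * y ≈ x + fromℕ (toℕ j) →
        F y ≋ tail (S j (x ∷ F x))
      graph-step j {x} {y} 0≤x x≤1 Ky≈x+j i = begin-equality
        F y i                                                 ≈⟨ dilation y i ⟩
        sum term                                              ≈⟨ sum-truncate term j above ⟩
        term j + sum {toℕ j} (λ a → term (inject {i = j} a))  ≈⟨ +-cong (*-congˡ (∗-cong (B j) (continuous⇒cong continuous at) i))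
                                                                   (sum-cong-≋ λ a → *-congˡ (∗-cong (B (inject {i = j} a)) (atLeast1 _ (below a)) i)) ⟩
        tail (S j (x ∷ F x)) i                                ∎
        where
        open ≤R
        term : Vector ℝ (suc k)
        term a = ρ ⁻¹ * (B a ∗ F (K * y - fromℕ (toℕ a))) i
        argument : ∀ a → K * y - fromℕ (toℕ {suc k} a) ≈ x + (fromℕ (toℕ j) - fromℕ (toℕ a))
        argument a = trans (+-congʳ Ky≈x+j) (+-assoc _ _ _)
        at : K * y - fromℕ (toℕ j) ≈ x
        at = trans (argument j) (trans (+-congˡ (-‿inverseʳ _)) (+-identityʳ x))
        above : ∀ a → toℕ j ℕ.< toℕ a → term a ≈ 0#
        above a j<a = trans (*-congˡ (∗-zeroʳ (B a) (atMost0 _ arg≤0) i)) (zeroʳ _)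
          where
          arg≤0 : K * y - fromℕ (toℕ a) ≤ 0#
          arg≤0 = ≤-respˡ-≈ (sym (argument a)) (≤-by _ (+-nonneg (0≤y-x x≤1) (0≤y-x (fromℕ-< j<a)))
            (solve 3 (λ x j a → :0 := (x :+ (j :- a)) :+ ((:1 :- x) :+ ((a :- j) :- :1))) refl x (fromℕ (toℕ j)) (fromℕ (toℕ a))))
        below : ∀ a → 1# ≤ K * y - fromℕ (toℕ (inject {i = j} a))
        below a = ≤-respʳ-≈ (sym (argument (inject {i = j} a))) (≤-trans
          (fromℕ-< (≡.subst (ℕ._< toℕ j) (≡.sym (Fin.toℕ-inject a)) (Fin.toℕ<n a)))
          (≤-by x 0≤x (+-comm _ _)))

      K*[t*K⁻¹]≈t : ∀ t → K * (t * K ⁻¹) ≈ t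
      K*[t*K⁻¹]≈t t = begin-equality
        K * (t * K ⁻¹)      ≈⟨ solve 3 (λ k t i → k :* (t :* i) := t :* (k :* i)) refl K t (K ⁻¹) ⟩
        t * (K * K ⁻¹)      ≈⟨ *-congˡ (x*x⁻¹≈1 (0<fromℕ k)) ⟩
        t * 1#              ≈⟨ *-identityʳ t ⟩
        t                   ∎
        where open ≤R

      graph-invariant : Graph F ≐ ⋃[ j ∶ Fin (suc k) ] Image (S j) (Graph F)
      graph-invariant = ⊆-union , union-⊆
        where
        open ≤R
        ⊆-union : Graph F ⊆ ⋃[ j ∶ Fin (suc k) ] Image (S j) (Graph F)
        ⊆-union {p} (y , 0≤y , y≤1 , p≋y∷Fy) =
          let (j , j≤Ky , Ky≤1+j) = locate k (K * y) (*-nonneg (0≤fromℕ (suc k)) 0≤y)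
                (≤-respʳ-≈ (*-identityʳ K) (*-monoˡ-≤ K (0≤fromℕ (suc k)) y≤1))
              x     = K * y - fromℕ (toℕ j)
              0≤x   = 0≤y-x j≤Ky
              x≤1   = ≤-by _ (0≤y-x Ky≤1+j)
                        (solve 2 (λ t j → :1 := (t :- j) :+ ((:1 :+ j) :- t)) refl (K * y) (fromℕ (toℕ j)))
              Ky≈x+j = solve 2 (λ t j → t := (t :- j) :+ j) refl (K * y) (fromℕ (toℕ j))
          in j , x ∷ F x , (x , 0≤x , x≤1 , λ _ → refl) , λ
            { zero    → trans (begin-equality
                (x + fromℕ (toℕ j)) * K ⁻¹   ≈⟨ *-congʳ Ky≈x+j ⟨
                K * y * K ⁻¹                 ≈⟨ *-assoc _ _ _ ⟩
                K * (y * K ⁻¹)               ≈⟨ K*[t*K⁻¹]≈t y ⟩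
                y                            ∎) (sym (p≋y∷Fy zero))
            ; (suc i) → trans (sym (graph-step j 0≤x x≤1 Ky≈x+j i)) (sym (p≋y∷Fy (suc i)))
            }
        union-⊆ : (⋃[ j ∶ Fin (suc k) ] Image (S j) (Graph F)) ⊆ Graph F
        union-⊆ {q} (j , p , (x , 0≤x , x≤1 , p≋x∷Fx) , Sp≋q) =
          y , *-nonneg 0≤x+j (<⇒≤ 0<K⁻¹) , y≤1 , λ
            { zero    → trans (sym (Sp≋q zero)) (ifs-cong j p≋x∷Fx zero)
            ; (suc i) → trans (sym (Sp≋q (suc i))) (trans (ifs-cong j p≋x∷Fx (suc i))
                          (sym (graph-step j 0≤x x≤1 (K*[t*K⁻¹]≈t _) i)))
            }
          where
          y : ℝ
          y = (x + fromℕ (toℕ j)) * K ⁻¹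
          0≤x+j : 0# ≤ x + fromℕ (toℕ j)
          0≤x+j = +-nonneg 0≤x (0≤fromℕ (toℕ j))
          y≤1 : y ≤ 1#
          y≤1 = begin
            (x + fromℕ (toℕ j)) * K ⁻¹    ≤⟨ *-monoʳ-≤ (<⇒≤ 0<K⁻¹) (+-mono-≤ x≤1 ≤-refl) ⟩
            fromℕ (suc (toℕ j)) * K ⁻¹    ≤⟨ *-monoʳ-≤ (<⇒≤ 0<K⁻¹) (fromℕ-mono-≤ (Fin.toℕ<n j)) ⟩
            K * K ⁻¹                      ≈⟨ x*x⁻¹≈1 (0<fromℕ k) ⟩
            1#                            ∎

      graph-attractor : 1 ℕ.≤ k → ∀ {ρ*} → IsJointSpectralRadius B ρ* → ρ* < ρ →
        IsSelfAffineAttractor S (Graph F)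
      graph-attractor 1≤k jsr ρ*<ρ =
        let (N , N-norm , c , 0≤c , c<1 , contract) = contractingNorm B jsr ρ*<ρ
            (c′ , 0≤c′ , c′<1 , contraction)        = ifs-contraction 1≤k N-norm 0≤c c<1 contract
            N⁺-norm                                 = prepend-bounded N-norm
            compact                                 = graph-compact {F = F} continuous
            nonempty                                = 0# ∷ F 0# , 0# , ≤-refl , <⇒≤ 0<1 , λ _ → refl
        in record
          { atLeastTwo  = ℕ.s≤s 1≤k
          ; affine      = ifs-affine
          ; contractive = prepend N , BoundedNorm.isNorm N⁺-norm , λ j → c′ , 0≤c′ , c′<1 , contraction j
          ; nonempty    = nonempty
          ; compact     = compact
          ; invariant   = graph-invariant
          ; unique      = λ L L-nonempty L-compact (L⊆ , ⊆L) →
              let (G⊆ , ⊆G) = graph-invariant in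
                invariant-⊆ N⁺-norm 0≤c′ c′<1 contraction L-compact nonempty compact L⊆ G⊆ ⊆G
              , invariant-⊆ N⁺-norm 0≤c′ c′<1 contraction compact L-nonempty L-compact G⊆ L⊆ ⊆L
          }

open import Data.Nat.Base using (_≤_)

theorem2 :
    ExcludedMiddle 0ℓ →
    (R : CompleteOrderedField) →
    let open Analysis R
        open LinearAlgebra (CompleteOrderedField.rawRing R) using (IsEigenvector) in
    (k : ℕ) → 2 ≤ k →
    (f : Sequence) → IsRegular k f →
    (d : ℕ) (fs : Vector Sequence (suc d)) →
    IsIntegerBasis (ℚ-Span (Kernel k f)) fs → fs zero ≗ f →
    (Bℤ : Vector (Matrix ℤ (suc d)) k) → AreDigitMatrices fs Bℤ →
    let B = λ (a : Fin k) → realMatrix (Bℤ a)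
        Bsum = realMatrix (digitSum Bℤ) in
    (ρ : ℝ) → IsSpectralRadius Bsum ρ → IsUniqueDominantEigenvalue Bsum ρ →
    (ρ* : ℝ) → IsJointSpectralRadius B ρ* → ρ* <ℝ ρ →
    (v : Vector ℝ (suc d)) → IsEigenvector Bsum ρ v →
    (F : ℝ → Vector ℝ (suc d)) → IsDilationSolution B ρ v F →
    let S = ifs B ρ v
        𝓕 = Graph F in
    (𝓕 ≐ ⋃[ j ∶ Fin k ] Image (S j) 𝓕) × IsSelfAffineAttractor S 𝓕
theorem2 em R (suc k) (ℕ.s≤s 1≤k) f _ d fs _ _ Bℤ _ ρ _ _ ρ* jsr ρ*<ρ v _ F F-sol =
    graph-invariant B ρ v F-sol , graph-attractor B ρ v F-sol 1≤k jsr ρ*<ρ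
  where
  open Attractor em R
  open Analysis R
  B : Vector (Matrix ℝ (suc d)) (suc k)
  B a = realMatrix (Bℤ a)
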